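{- Let $\mathcal{C}$ be a nondegenerate $[n,k]_{q^m/q}$ code and let $\mathcal{U}$ be any corresponding $[n,k]_{q^m/q}$ system. Then $$\ell(\mathcal{U})=k-\min\{r\in\{0,1,\dots,k\}: d^{\mathrm{rk}}_r(\mathcal{C})=n-(k-r)m\}.$$
   Context: Let $q$ be a prime power and $n,m,k$ positive integers. For $v\in\mathbb{F}_{q^m}^n$ and an ordered basis $\Gamma=(\gamma_1,\dots,\gamma_m)$ of $\mathbb{F}_{q^m}$ over $\mathbb{F}_q$, let $\Gamma(v)\in\mathbb{F}_q^{n\times m}$ be the matrix with $v_i=\sum_{j}\Gamma(v)_{ij}\gamma_j$. The rank support $\sigma^{\mathrm{rk}}(v)\subseteq\mathbb{F}_q^n$ is the column space of $\Gamma(v)$ (independent of $\Gamma$). An $[n,k]_{q^m/q}$ code is a $k$-dimensional $\mathbb{F}_{q^m}$-subspace $\mathcal{C}\subseteq\mathbb{F}_{q^m}^n$; it is nondegenerate if $\sum_{v\in\mathcal{C}}\sigma^{\mathrm{rk}}(v)=\mathbb{F}_q^n$. An $[n,k]_{q^m/q}$ system is an $n$-dimensional $\mathbb{F}_q$-subspace $\mathcal{U}\subseteq\mathbb{F}_{q^m}^k$ with $\langle\mathcal{U}\rangle_{\mathbb{F}_{q^m}}=\mathbb{F}_{q^m}^k$. A system corresponding to a nondegenerate code $\mathcal{C}$ is the $\mathbb{F}_q$-span of the columns of a generator matrix $G\in\mathbb{F}_{q^m}^{k\times n}$ of $\mathcal{C}$. The linearity index of $\mathcal{U}$ is $\ell(\mathcal{U})=\max\{\dim_{\mathbb{F}_{q^m}}(H):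 H\subseteq\mathbb{F}_{q^m}^k \text{ an } \mathbb{F}_{q^m}\text{ -subspace with } H\subseteq\mathcal{U}\}$. Let $\theta$ be the map $x\mapsto x^q$ applied componentwise to $\mathbb{F}_{q^m}^n$, and let $\Lambda_q(n,m)$ be the set of $\mathbb{F}_{q^m}$-subspaces $\mathcal{V}\le\mathbb{F}_{q^m}^n$ with $\theta(\mathcal{V})=\mathcal{V}$. For $1\le r\le k$, the $r$-th generalized rank weight is $d^{\mathrm{rk}}_r(\mathcal{C})=\min\{\dim_{\mathbb{F}_{q^m}}(\mathcal{V}):\mathcal{V}\in\Lambda_q(n,m),\ \dim_{\mathbb{F}_{q^m}}(\mathcal{V}\cap\mathcal{C})\ge r\}$, and $d^{\mathrm{rk}}_0(\mathcal{C})=0$. -}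

module Defs where

open import Algebra.Bundles using (Semiring; Ring; CommutativeRing)
open import Algebra.Definitions.RawMonoid using (sum)
import Algebra.Definitions.RawSemiring as RawSemiringDefs
open import Algebra.Module.Bundles using (LeftModule)
import Algebra.Module.Construct.TensorUnit as TensorUnit
open import Algebra.Morphism.Bundles using (RingHomomorphism)
open import Data.Fin.Base using (Fin)
open import Data.Nat.Base using (ℕ; zero; suc; _^_; _≤_)
open import Data.Nat.Primality using (Prime)
open import Data.Nat.Properties using (≤-antisym)
open import Data.Product.Base using (_×_; _,_; ∃; ∃-syntax; ∃₂; proj₁; proj₂)
open import Data.Vec.Functional using (Vector)
open import Function.Bundles using (Inverse)
open import Level using (0ℓ; Lift)
open import Relation.Binary.PropositionalEquality using (_≡_)
import Relation.Binary.PropositionalEquality as ≡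
open import Relation.Nullary.Negation using (¬_)
open import Relation.Unary using (Pred; _∈_; _⊆_; _∩_; _≐_; U)

IsMinimum IsMaximum : ∀ {a} → Pred ℕ a → ℕ → Set a
IsMinimum P x = x ∈ P × (∀ {y} → y ∈ P → x ≤ y)
IsMaximum P x = x ∈ P × (∀ {y} → y ∈ P → y ≤ x)

minimum-unique : ∀ {a} {P : Pred ℕ a} {x y} → IsMinimum P x → IsMinimum P y → x ≡ y
minimum-unique (px , x≤) (py , y≤) = ≤-antisym (x≤ py) (y≤ px)

maximum-unique : ∀ {a} {P : Pred ℕ a} {x y} → IsMaximum P x → IsMaximum P y → x ≡ y
maximum-unique (px , ≤x) (py , ≤y) = ≤-antisym (≤y px) (≤x py)

IsPrimePower : ℕ → Set
IsPrimePower q = ∃[ p ] ∃[ e ] (Prime p × q ≡ p ^ suc e)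

-- A field with s elements, as a setoid-based ring: the bijection with Fin s
-- is one of setoids, so s counts classes of ≈ (and ≈ is decidable).
record FiniteField (s : ℕ) : Set₁ where
  field
    commutativeRing : CommutativeRing 0ℓ 0ℓ
  open CommutativeRing commutativeRing public
  field
    1≉0      : ¬ (1# ≈ 0#)
    inverse  : ∀ x → ¬ (x ≈ 0#) → ∃[ y ] (x * y ≈ 1#)
    counting : Inverse setoid (≡.setoid (Fin s))

module _ {R : Ring 0ℓ 0ℓ} (M : LeftModule R 0ℓ 0ℓ) where
  open LeftModule M

  infixr 8 _^ᴹ_
  _^ᴹ_ : ℕ → LeftModule R 0ℓ 0ℓ
  _^ᴹ_ n = record
    { Carrierᴹ = Vector Carrierᴹ n
    ; _≈ᴹ_ = λ v w → ∀ i → v i ≈ᴹ w i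
    ; _+ᴹ_ = λ v w i → v i +ᴹ w i
    ; _*ₗ_ = λ a v i → a *ₗ v i
    ; 0ᴹ = λ _ → 0ᴹ
    ; -ᴹ_ = λ v i → -ᴹ v i
    ; isLeftModule = record
      { isLeftSemimodule = record
        { +ᴹ-isCommutativeMonoid = record
          { isMonoid = record
            { isSemigroup = record
              { isMagma = record
                { isEquivalence = record
                  { refl = λ _ → ≈ᴹ-refl
                  ; sym = λ p i → ≈ᴹ-sym (p i)
                  ; trans = λ p q i → ≈ᴹ-trans (p i) (q i)
                  }
                ; ∙-cong = λ p q i → +ᴹ-cong (p i) (q i)
                }
              ; assoc = λ u v w i → +ᴹ-assoc (u i) (v i) (w i)
              }
            ; identity = (λ v i → +ᴹ-identityˡ (v i)) , (λ v i → +ᴹ-identityʳ (v i))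
            }
          ; comm = λ v w i → +ᴹ-comm (v i) (w i)
          }
        ; isPreleftSemimodule = record
          { *ₗ-cong = λ a≈b p i → *ₗ-cong a≈b (p i)
          ; *ₗ-zeroˡ = λ v i → *ₗ-zeroˡ (v i)
          ; *ₗ-distribʳ = λ v a b i → *ₗ-distribʳ (v i) a b
          ; *ₗ-identityˡ = λ v i → *ₗ-identityˡ (v i)
          ; *ₗ-assoc = λ a b v i → *ₗ-assoc a b (v i)
          ; *ₗ-zeroʳ = λ a i → *ₗ-zeroʳ a
          ; *ₗ-distribˡ = λ a v w i → *ₗ-distribˡ a (v i) (w i)
          }
        }
      ; -ᴹ‿cong = λ p i → -ᴹ‿cong (p i)
      ; -ᴹ‿inverse = (λ v i → -ᴹ‿inverseˡ (v i)) , (λ v i → -ᴹ‿inverseʳ (v i))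
      }
    }

module _ {R S : Ring 0ℓ 0ℓ}
         (φ : RingHomomorphism (Ring.rawRing R) (Ring.rawRing S)) where
  open RingHomomorphism φ

  restrictScalars : LeftModule S 0ℓ 0ℓ → LeftModule R 0ℓ 0ℓ
  restrictScalars M = record
    { Carrierᴹ = Carrierᴹ
    ; _≈ᴹ_ = _≈ᴹ_
    ; _+ᴹ_ = _+ᴹ_
    ; _*ₗ_ = λ a x → ⟦ a ⟧ *ₗ x
    ; 0ᴹ = 0ᴹ
    ; -ᴹ_ = -ᴹ_
    ; isLeftModule = record
      { isLeftSemimodule = record
        { +ᴹ-isCommutativeMonoid = +ᴹ-isCommutativeMonoid
        ; isPreleftSemimodule = record
          { *ₗ-cong = λ a≈b → *ₗ-cong (⟦⟧-cong a≈b)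
          ; *ₗ-zeroˡ = λ x → ≈ᴹ-trans (*ₗ-congʳ 0#-homo) (*ₗ-zeroˡ x)
          ; *ₗ-distribʳ = λ x a b →
              ≈ᴹ-trans (*ₗ-congʳ (+-homo a b)) (*ₗ-distribʳ x ⟦ a ⟧ ⟦ b ⟧)
          ; *ₗ-identityˡ = λ x → ≈ᴹ-trans (*ₗ-congʳ 1#-homo) (*ₗ-identityˡ x)
          ; *ₗ-assoc = λ a b x →
              ≈ᴹ-trans (*ₗ-congʳ (*-homo a b)) (*ₗ-assoc ⟦ a ⟧ ⟦ b ⟧ x)
          ; *ₗ-zeroʳ = λ a → *ₗ-zeroʳ ⟦ a ⟧
          ; *ₗ-distribˡ = λ a → *ₗ-distribˡ ⟦ a ⟧
          }
        }
      ; -ᴹ‿cong = -ᴹ‿cong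
      ; -ᴹ‿inverse = -ᴹ‿inverse
      }
    }
    where open LeftModule M

module LinearAlgebra {R : Ring 0ℓ 0ℓ} (M : LeftModule R 0ℓ 0ℓ) where
  open Ring R using (Carrier; _≈_; 0#)
  open LeftModule M

  record Subspace : Set₁ where
    field
      Member    : Pred Carrierᴹ 0ℓ
      ≈-closed  : ∀ {x y} → x ≈ᴹ y → x ∈ Member → y ∈ Member
      0-closed  : 0ᴹ ∈ Member
      +-closed  : ∀ {x y} → x ∈ Member → y ∈ Member → x +ᴹ y ∈ Member
      *ₗ-closed : ∀ a {x} → x ∈ Member → a *ₗ x ∈ Member

  ∑ : ∀ {t} → Vector Carrierᴹ t → Carrierᴹ
  ∑ = sum +ᴹ-rawMonoid

  combination : ∀ {t} → Vector Carrier t → Vector Carrierᴹ t → Carrierᴹ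
  combination a b = ∑ (λ i → a i *ₗ b i)

  -- Span of a finite family, then of an arbitrary subset.
  Span : ∀ {t} → Vector Carrierᴹ t → Pred Carrierᴹ 0ℓ
  Span b x = ∃[ a ] (x ≈ᴹ combination a b)

  ⟨_⟩ : Pred Carrierᴹ 0ℓ → Pred Carrierᴹ 0ℓ
  ⟨ S ⟩ x = ∃₂ λ t (b : Vector Carrierᴹ t) → (∀ i → b i ∈ S) × x ∈ Span b

  -- The sum of the subspaces W i over all i with I i.
  SumOver : {A : Set} → Pred A 0ℓ → (A → Pred Carrierᴹ 0ℓ) → Pred Carrierᴹ 0ℓ
  SumOver I W x = ∃₂ λ t (w : Vector Carrierᴹ t) →
    (∀ j → ∃[ i ] (i ∈ I × w j ∈ W i)) × x ≈ᴹ ∑ w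

  LinearlyIndependent : ∀ {t} → Vector Carrierᴹ t → Set
  LinearlyIndependent b = ∀ a → combination a b ≈ᴹ 0ᴹ → ∀ i → a i ≈ 0#

  record IsBasis {d} (b : Vector Carrierᴹ d) (S : Pred Carrierᴹ 0ℓ) : Set where
    field
      inside      : ∀ i → b i ∈ S
      independent : LinearlyIndependent b
      spanning    : S ⊆ Span b

  -- Meant for predicates S that define a subspace.
  HasDimension : Pred Carrierᴹ 0ℓ → ℕ → Set
  HasDimension S d = ∃[ b ] IsBasis {d} b S

open LinearAlgebra public using (Subspace; module Subspace)

-- F and K are 𝔽_q and 𝔽_{q^m}, with the inclusion 𝔽_q ⊆ 𝔽_{q^m} given by ι.
module RankMetric {q m : ℕ} (F : FiniteField q) (K : FiniteField (q ^ m))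
                  (ι : RingHomomorphism (FiniteField.rawRing F) (FiniteField.rawRing K))
                  where
  private
    module F = FiniteField F
    module K = FiniteField K

  F^ : ℕ → LeftModule F.ring 0ℓ 0ℓ
  F^ n = TensorUnit.leftModule ^ᴹ n

  K^ : ℕ → LeftModule K.ring 0ℓ 0ℓ
  K^ n = TensorUnit.leftModule ^ᴹ n

  K/F : LeftModule F.ring 0ℓ 0ℓ
  K/F = restrictScalars {F.ring} {K.ring} ι TensorUnit.leftModule

  K^_/F : ℕ → LeftModule F.ring 0ℓ 0ℓ
  K^ n /F = restrictScalars {F.ring} {K.ring} ι (K^ n)

  private
    module F^ n = LinearAlgebra (F^ n)
    module K^ n = LinearAlgebra (K^ n)
    module K/F = LinearAlgebra K/F
    module K^/F n = LinearAlgebra (K^ n /F)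

  record OrderedBasis : Set where
    field
      γ       : Vector K.Carrier m
      isBasis : K/F.IsBasis γ U

    -- The matrix Γ(v), with v i ≈ ∑ⱼ ι (expand v i j) * γ j.
    expand : ∀ {n} → Vector K.Carrier n → Fin n → Fin m → F.Carrier
    expand v i = proj₁ (K/F.IsBasis.spanning isBasis {v i} _)

  rankSupport : OrderedBasis → ∀ {n} → Vector K.Carrier n → Pred (Vector F.Carrier n) 0ℓ
  rankSupport Γ {n} v = F^.Span n (λ j i → OrderedBasis.expand Γ v i j)

  record Code (n k : ℕ) : Set₁ where
    field
      subspace  : Subspace (K^ n)
      dimension : K^.HasDimension n (Subspace.Member subspace) k
    open Subspace subspace public

  Nondegenerate : OrderedBasis → ∀ {n k} → Code n k → Set
  Nondegenerate Γ {n} C = ∀ x → x ∈ F^.SumOver n (Code.Member C) (rankSupport Γ)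

  record System (n k : ℕ) : Set₁ where
    field
      subspace  : Subspace (K^ k /F)
      dimension : K^/F.HasDimension k (Subspace.Member subspace) n
      spanning  : ∀ x → x ∈ K^.⟨_⟩ k (Subspace.Member subspace)
    open Subspace subspace public

  -- The rows of G form a basis of C.
  IsGeneratorMatrix : ∀ {n k} → (Fin k → Fin n → K.Carrier) → Code n k → Set
  IsGeneratorMatrix {n} G C = K^.IsBasis n G (Code.Member C)

  _CorrespondsTo_ : ∀ {n k} → System n k → Code n k → Set
  _CorrespondsTo_ {n} {k} 𝒰 C = ∃[ G ]
    (IsGeneratorMatrix G C × System.Member 𝒰 ≐ K^/F.Span k (λ j i → G i j))

  IsLinearityIndex : ∀ {n k} → System n k → ℕ → Set₁
  IsLinearityIndex {n} {k} 𝒰 = IsMaximum λ d → ∃ λ (H : Subspace (K^ k)) →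
    Subspace.Member H ⊆ System.Member 𝒰 × K^.HasDimension k (Subspace.Member H) d

  θ : ∀ {n} → Vector K.Carrier n → Vector K.Carrier n
  θ v i = RawSemiringDefs._^_ (Semiring.rawSemiring K.semiring) (v i) q

  -- V ∈ Λ_q(n,m)
  θ-Invariant : ∀ {n} → Subspace (K^ n) → Set
  θ-Invariant {n} V = (λ y → ∃[ x ] (x ∈ Subspace.Member V × θ x ≈ᴹ y)) ≐ Subspace.Member V
    where open LeftModule (K^ n) using (_≈ᴹ_)

  -- IsGeneralizedRankWeight C r w means that d_r(C) = w.
  IsGeneralizedRankWeight : ∀ {n k} → Code n k → ℕ → ℕ → Set₁
  IsGeneralizedRankWeight C zero w = Lift _ (w ≡ 0)
  IsGeneralizedRankWeight {n} C r@(suc _) = IsMinimum λ d → ∃ λ (V : Subspace (K^ n)) →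
    θ-Invariant V
    × (∃[ e ] (K^.HasDimension n (Subspace.Member V ∩ Code.Member C) e × r ≤ e))
    × K^.HasDimension n (Subspace.Member V) d

-- For x ∈ K^k let xG be the corresponding codeword, and for u ∈ F^n let Gu be the
-- corresponding point of 𝒰, so that xG · u = x · Gu. A θ-invariant V has a systematic
-- basis fixed by θ, hence with entries in F, so V is the dual of an F-rational space of
-- dimension n − dim V. The points Gu of its rational vectors u lie in X^⊥, where
-- X = {x | xG ∈ V} has dimension dim (V ∩ C). Counting elements gives
-- n − dim V ≤ m (k − r) whenever dim (V ∩ C) ≥ r, and equality forces X^⊥ ⊆ 𝒰 with
-- dim X^⊥ = k − r. Conversely, the largest K-subspace H = {x | Kx ⊆ 𝒰} of 𝒰 has dimension
-- ℓ(𝒰), and the dual V of {u | Gu ∈ H} attains the bound for r = k − ℓ(𝒰).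
module Submission where

open import Defs
open import Algebra.Bundles using (CommutativeMonoid; CommutativeSemiring; Ring)
open import Algebra.Module.Bundles using (LeftModule)
import Algebra.Module.Construct.TensorUnit as TensorUnit
open import Algebra.Morphism.Bundles using (RingHomomorphism)
open import Data.Fin.Base using (Fin; zero; suc; toℕ; fromℕ; inject₁; funToFin; finToFun; punchOut; combine)
import Data.Fin.Permutation as Permutation
import Data.Fin.Properties as Fin
import Data.Integer.Properties as ℤ
open import Data.Nat.Base as ℕ using (ℕ; zero; suc; _≤_; _<_; _^_; _∸_; _!; z≤n; s≤s; NonZero)
open import Data.Nat.Combinatorics using (nCk≡n!/k![n-k]!; k![n∸k]!∣n!; nCn≡1) renaming (_C_ to infixl 6.5 _choose_)
open import Data.Nat.Divisibility using (_∣_; _∤_; divides; ∣⇒≤; m∣m*n; ∣1⇒≡1)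
open import Data.Nat.DivMod using (m/n*n≡m)
open import Data.Nat.Primality using (Prime; euclidsLemma; ¬prime[1])
import Data.Nat.Properties as ℕ
open import Data.Product.Base using (_×_; _,_; ∃; ∃-syntax; proj₁; proj₂)
open import Data.Sum.Base using (_⊎_; inj₁; inj₂; [_,_]′)
open import Data.Vec.Functional using (Vector; tail; removeAt) renaming (_∷_ to infixr 5 _∷_)
open import Data.Vec.Functional.Relation.Binary.Equality.Setoid using (≋-setoid)
open import Function.Base using (_∘_)
open import Function.Bundles using (Inverse)
import Function.Construct.Identity as Identity
open import Function.Definitions using (Injective; StrictlySurjective)
open import Level using (0ℓ; lift)
open import Relation.Binary.Bundles using (Setoid)
open import Relation.Binary.PropositionalEquality as ≡ using (_≡_; _≢_; _≗_; cong; cong₂)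
import Relation.Binary.Reasoning.Setoid as ≈-Reasoning
open import Relation.Nullary.Decidable using (Dec; yes; no; map′; ¬?; _×-dec_)
open import Relation.Nullary.Negation using (¬_; contradiction)
open import Relation.Unary using (Pred; Decidable; _∈_; _⊆_; _≐_; _∩_)

-- Finite setoids

-- Every dimension comparison here is a comparison of cardinalities. Subspaces are arbitrary
-- predicates, so what makes them tractable is decidable membership: finiteness allows an exhaustive
-- search for pivots and hence a reduced echelon form (I | A). The same matrix A describes the
-- subspace and its dual, and the complementary dimensions are just the numbers of pivot and free
-- coordinates, so neither rank-nullity nor a double-dual argument is called for. The obstacle is
-- the mixture of scalars. An F-dimension c and a K-dimension c′ are compared through an injection
-- F^c → K^c′, which gives c ≤ m c′. When the two sides agree, finiteness makes the injection a
-- bijection, and this turns a numerical equality into an inclusion of subspaces. Two facts about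
-- fields come from their sizes alone. The Frobenius map is additive because the size of K
-- annihilates 1, which reveals the characteristic. An element fixed by x ↦ x^q lies in F because
-- the image of F already supplies q roots of x^q - x.

private
  Counted : Setoid 0ℓ 0ℓ → ℕ → Set
  Counted A a = Inverse A (≡.setoid (Fin a))

-- If `y` were missed, punching it out of the codomain would leave an injection from `Fin (suc n)`
-- into `Fin n`.
Fin-injective⇒surjective : ∀ {n} (f : Fin n → Fin n) → Injective _≡_ _≡_ f → StrictlySurjective _≡_ f
Fin-injective⇒surjective {suc n} f inj y with Fin.any? (λ x → f x Fin.≟ y)
... | yes hit  = hit
... | no  miss = contradiction
  (Fin.injective⇒≤ {f = λ x → punchOut (y≢f x)} (λ {x} {x′} eq → inj (Fin.punchOut-injective (y≢f x) (y≢f x′) eq)))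
  ℕ.1+n≰n
  where
  y≢f : ∀ x → y ≢ f x
  y≢f x y≡fx = miss (x , ≡.sym y≡fx)

module _ {A B : Setoid 0ℓ 0ℓ} {a b : ℕ} (countA : Counted A a) (countB : Counted B b)
         (f : Setoid.Carrier A → Setoid.Carrier B)
         (f-injective : Injective (Setoid._≈_ A) (Setoid._≈_ B) f) where
  private
    module A = Setoid A
    module B = Setoid B
    module #A = Inverse countA
    module #B = Inverse countB

    f# : Fin a → Fin b
    f# i = #B.to (f (#A.from i))

    f#-injective : Injective _≡_ _≡_ f#
    f#-injective {i} {j} eq = ≡.trans (≡.sym (#A.strictlyInverseˡ i)) (≡.trans (#A.to-cong (f-injective
      (B.trans (B.sym (#B.strictlyInverseʳ _)) (B.trans (#B.from-cong eq) (#B.strictlyInverseʳ _)))))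
      (#A.strictlyInverseˡ j))

  injective⇒≤ : a ≤ b
  injective⇒≤ = Fin.injective⇒≤ f#-injective

  injective⇒surjective : a ≡ b → StrictlySurjective B._≈_ f
  injective⇒surjective ≡.refl y with i , eq ← Fin-injective⇒surjective f# f#-injective (#B.to y) =
    #A.from i , B.trans (B.sym (#B.strictlyInverseʳ _)) (B.trans (#B.from-cong eq) (#B.strictlyInverseʳ _))

-- A section of `f` is injective, hence surjective. So both arguments lie in its image, where `f`
-- can be undone.
Fin-surjective⇒injective : ∀ {n} (f : Fin n → Fin n) → StrictlySurjective _≡_ f → Injective _≡_ _≡_ f
Fin-surjective⇒injective f surj {i} {j} fi≡fj = go (section-surjective i) (section-surjective j)
  where
  section = proj₁ ∘ surj

  section-surjective : StrictlySurjective _≡_ section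
  section-surjective = Fin-injective⇒surjective section λ {x} {y} eq →
    ≡.trans (≡.sym (proj₂ (surj x))) (≡.trans (cong f eq) (proj₂ (surj y)))

  go : ∃[ x ] section x ≡ i → ∃[ y ] section y ≡ j → i ≡ j
  go (x , ≡.refl) (y , ≡.refl) =
    cong section (≡.trans (≡.sym (proj₂ (surj x))) (≡.trans fi≡fj (proj₂ (surj y))))

surjective⇒injective : ∀ {A : Setoid 0ℓ 0ℓ} {a} → Counted A a → let open Setoid A in
  (f : Carrier → Carrier) → (∀ {x y} → x ≈ y → f x ≈ f y) → StrictlySurjective _≈_ f → Injective _≈_ _≈_ f
surjective⇒injective {A} countA f f-cong surj {x} {y} fx≈fy =
  trans (sym (#.strictlyInverseʳ x)) (trans (#.from-cong (Fin-surjective⇒injective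
    (#.to ∘ f ∘ #.from)
    (λ i → #.to (proj₁ (surj (#.from i))) ,
           ≡.trans (#.to-cong (trans (f-cong (#.strictlyInverseʳ _)) (proj₂ (surj (#.from i))))) (#.strictlyInverseˡ i))
    (#.to-cong (trans (f-cong (#.strictlyInverseʳ x)) (trans fx≈fy (sym (f-cong (#.strictlyInverseʳ y))))))))
    (#.strictlyInverseʳ y))
  where
  open Setoid A
  module # = Inverse countA

module _ {A : Setoid 0ℓ 0ℓ} {a : ℕ} (countA : Counted A a)
         {P : Pred (Setoid.Carrier A) 0ℓ} (P-resp : ∀ {x y} → Setoid._≈_ A x y → P x → P y)
         (P? : Decidable P) where
  private
    module A = Setoid A
    module #A = Inverse countA

  finite-any? : Dec (∃ P)
  finite-any? = map′ (λ (i , p) → #A.from i , p) (λ (x , p) → #A.to x , P-resp (A.sym (#A.strictlyInverseʳ x)) p)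
    (Fin.any? (P? ∘ #A.from))

  finite-all? : Dec (∀ x → P x)
  finite-all? = map′ (λ p x → P-resp (#A.strictlyInverseʳ x) (p (#A.to x))) (λ p i → p (#A.from i))
    (Fin.all? (P? ∘ #A.from))

funToFin-cong : ∀ {m n} {f g : Fin m → Fin n} → f ≗ g → funToFin f ≡ funToFin g
funToFin-cong {zero}  f≗g = ≡.refl
funToFin-cong {suc m} f≗g = cong₂ combine (f≗g zero) (funToFin-cong (f≗g ∘ suc))

vectorCounted : ∀ {A a} → Counted A a → ∀ n → Counted (≋-setoid A n) (a ^ n)
vectorCounted {A} {a} countA n = record
  { to = λ v → funToFin (#A.to ∘ v)
  ; from = λ k → #A.from ∘ finToFun {a} {n} k
  ; to-cong = λ eq → funToFin-cong (#A.to-cong ∘ eq)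
  ; from-cong = λ { ≡.refl i → A.refl }
  ; inverse =
      (λ { {k} eq → ≡.trans (funToFin-cong λ i →
             ≡.trans (#A.to-cong (eq i)) (#A.strictlyInverseˡ _)) (Fin.funToFin-finToFin {n} {a} k) })
    , (λ { {v} ≡.refl i → A.trans (#A.from-cong (Fin.finToFun-funToFin (#A.to ∘ v) i)) (#A.strictlyInverseʳ (v i)) })
  }
  where
  module A = Setoid A
  module #A = Inverse countA

≟-counted : ∀ {A a} → Counted A a → ∀ x y → Dec (Setoid._≈_ A x y)
≟-counted {A} countA x y = map′
  (λ eq → A.trans (A.sym (#A.strictlyInverseʳ x)) (A.trans (#A.from-cong eq) (#A.strictlyInverseʳ y)))
  #A.to-cong (#A.to x Fin.≟ #A.to y)
  where
  module A = Setoid A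
  module #A = Inverse countA

-- Frobenius powers in finite fields

prime∤! : ∀ {p k} → Prime p → k < p → p ∤ k !
prime∤! {k = zero}  pr k<p p∣1 = ¬prime[1] (≡.subst Prime (∣1⇒≡1 p∣1) pr)
prime∤! {k = suc k} pr k<p p∣k! with euclidsLemma (suc k) (k !) pr p∣k!
... | inj₁ p∣k  = ℕ.<⇒≱ k<p (∣⇒≤ p∣k)
... | inj₂ p∣k′ = prime∤! pr (ℕ.<-trans (ℕ.n<1+n k) k<p) p∣k′

-- `p` divides p! = C(p,k) · k! · (p - k)!, but neither factorial, since both are products of
-- numbers below `p`.
prime∣C : ∀ {p k} → Prime p → .{{NonZero k}} → k < p → p ∣ p choose k
prime∣C {p@(suc p′)} {k@(suc k′)} pr k<p
  with euclidsLemma (p choose k) (k ! ℕ.* (p ∸ k) !) pr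
         (≡.subst (p ∣_) (≡.sym C*k!≡p!) (m∣m*n (p′ !)))
  where
  instance _ = k ℕ.!* (p ∸ k) !≢0
  C*k!≡p! : (p choose k) ℕ.* (k ! ℕ.* (p ∸ k) !) ≡ p !
  C*k!≡p! = ≡.trans (cong (ℕ._* (k ! ℕ.* (p ∸ k) !)) (nCk≡n!/k![n-k]! (ℕ.<⇒≤ k<p)))
                    (m/n*n≡m (k![n∸k]!∣n! (ℕ.<⇒≤ k<p)))
... | inj₁ p∣C = p∣C
... | inj₂ p∣k!j! = contradiction (euclidsLemma (k !) ((p ∸ k) !) pr p∣k!j!)
        [ prime∤! pr k<p , prime∤! pr (s≤s (ℕ.m∸n≤m p′ k′)) ]′

module PrimeCharacteristic (R : CommutativeSemiring 0ℓ 0ℓ) {p} (p-prime : Prime p) where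
  open CommutativeSemiring R hiding (zero)
  open import Algebra.Properties.Semiring.Exp semiring using (^-congˡ; ^-assocʳ) renaming (_^_ to _^ᴿ_)
  open import Algebra.Properties.Semiring.Mult semiring using (×-assocˡ; ×-homo-1; ×-congʳ; ×-assoc-*)
    renaming (_×_ to _×ᴿ_)
  open import Algebra.Properties.Semiring.Sum semiring using (sum; sum-init-last; sum-cong-≋; sum-replicate-zero)
  open import Algebra.Properties.CommutativeSemiring.Binomial R
  open ≈-Reasoning setoid

  ×-zeroʳ : ∀ n → n ×ᴿ 0# ≈ 0#
  ×-zeroʳ zero    = refl
  ×-zeroʳ (suc n) = trans (+-identityˡ _) (×-zeroʳ n)

  module _ (p×1≈0 : p ×ᴿ 1# ≈ 0#) where

    p∣n⇒n×x≈0 : ∀ {n} x → p ∣ n → n ×ᴿ x ≈ 0#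
    p∣n⇒n×x≈0 x (divides d ≡.refl) = begin
      (d ℕ.* p) ×ᴿ x  ≈⟨ ×-assocˡ x d p ⟨
      d ×ᴿ (p ×ᴿ x)   ≈⟨ ×-congʳ d (×-congʳ p (*-identityˡ x)) ⟨
      d ×ᴿ (p ×ᴿ (1# * x))   ≈⟨ ×-congʳ d (×-assoc-* p 1# x) ⟨
      d ×ᴿ (p ×ᴿ 1# * x)   ≈⟨ ×-congʳ d (trans (*-congʳ p×1≈0) (zeroˡ x)) ⟩
      d ×ᴿ 0# ≈⟨ ×-zeroʳ d ⟩
      0# ∎

    ^p-distrib-+ : ∀ x y → (x + y) ^ᴿ p ≈ x ^ᴿ p + y ^ᴿ p
    ^p-distrib-+ x y = go p-prime ≡.refl
      where
      -- `p` is a parameter of the module; a fresh `r` equal to it can be split as a successor,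
      -- which separates the two end terms of the binomial sum.
      go : ∀ {r} → Prime r → r ≡ p → (x + y) ^ᴿ r ≈ x ^ᴿ r + y ^ᴿ r
      go {r@(suc r′)} pr ≡.refl = begin
        (x + y) ^ᴿ r ≈⟨ theorem r x y ⟩
        sum term  ≈⟨ sum-init-last term ⟩
        (term zero + sum (λ i → term (inject₁ (suc i)))) + term (fromℕ r)
          ≈⟨ +-cong (+-cong (trans (×-homo-1 _) (*-identityˡ _))
                 (trans (sum-cong-≋ middle) (sum-replicate-zero r′))) last ⟩
        (y ^ᴿ r + 0#) + x ^ᴿ r ≈⟨ +-congʳ (+-identityʳ _) ⟩
        y ^ᴿ r + x ^ᴿ r ≈⟨ +-comm _ _ ⟩
        x ^ᴿ r + y ^ᴿ r ∎
        where
        term = binomialTerm x y r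
        middle : ∀ i → term (inject₁ (suc i)) ≈ 0#
        middle i = p∣n⇒n×x≈0 _ (prime∣C pr
          (≡.subst (ℕ._< r) (≡.sym (Fin.toℕ-inject₁ (suc i))) (s≤s (Fin.toℕ<n i))))
        last : term (fromℕ r) ≈ x ^ᴿ r
        last = begin
          (r choose toℕ (fromℕ r)) ×ᴿ (x ^ᴿ toℕ (fromℕ r) * y ^ᴿ (r ∸ toℕ (fromℕ r)))
            ≡⟨ cong (λ t → (r choose t) ×ᴿ (x ^ᴿ t * y ^ᴿ (r ∸ t))) (Fin.toℕ-fromℕ r) ⟩
          (r choose r) ×ᴿ (x ^ᴿ r * y ^ᴿ (r ∸ r))
            ≡⟨ cong₂ (λ t u → t ×ᴿ (x ^ᴿ r * y ^ᴿ u)) (nCn≡1 r) (ℕ.n∸n≡0 r) ⟩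
          1 ×ᴿ (x ^ᴿ r * 1#)
            ≈⟨ trans (×-homo-1 _) (*-identityʳ _) ⟩
          x ^ᴿ r ∎

    ^p^e-distrib-+ : ∀ e x y → (x + y) ^ᴿ (p ^ e) ≈ x ^ᴿ (p ^ e) + y ^ᴿ (p ^ e)
    ^p^e-distrib-+ zero    x y = trans (*-identityʳ _) (+-cong (sym (*-identityʳ _)) (sym (*-identityʳ _)))
    ^p^e-distrib-+ (suc e) x y = begin
      (x + y) ^ᴿ (p ℕ.* p ^ e)          ≈⟨ ^-assocʳ (x + y) p (p ^ e) ⟨
      ((x + y) ^ᴿ p) ^ᴿ (p ^ e)         ≈⟨ ^-congˡ (p ^ e) (^p-distrib-+ x y) ⟩
      (x ^ᴿ p + y ^ᴿ p) ^ᴿ (p ^ e)      ≈⟨ ^p^e-distrib-+ e _ _ ⟩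
      (x ^ᴿ p) ^ᴿ (p ^ e) + (y ^ᴿ p) ^ᴿ (p ^ e) ≈⟨ +-cong (^-assocʳ x p (p ^ e)) (^-assocʳ y p (p ^ e)) ⟩
      x ^ᴿ (p ℕ.* p ^ e) + y ^ᴿ (p ℕ.* p ^ e) ∎

module _ (M : CommutativeMonoid 0ℓ 0ℓ) {A : Setoid 0ℓ 0ℓ} {a} (countA : Counted A a) where
  private
    module M = CommutativeMonoid M
    module A = Setoid A
    module #A = Inverse countA
  open import Algebra.Properties.CommutativeMonoid.Sum M using (sum; sum-permute; sum-cong-≋)

  -- Stated for any commutative monoid because it serves twice: additively for `s×1≈0` and
  -- multiplicatively for `x^s≈x`.
  sum-reindex : (g : Inverse A A) (f : A.Carrier → M.Carrier) → (∀ {x y} → x A.≈ y → f x M.≈ f y) →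
                sum (f ∘ #A.from) M.≈ sum (f ∘ Inverse.to g ∘ #A.from)
  sum-reindex g f f-cong = M.trans (sum-permute (f ∘ #A.from) π)
    (sum-cong-≋ {a} λ i → f-cong (#A.strictlyInverseʳ (g.to (#A.from i))))
    where
    module g = Inverse g
    π : Permutation.Permutation a a
    π = Permutation.permutation (λ i → #A.to (g.to (#A.from i))) (λ i → #A.to (g.from (#A.from i)))
      (λ i → ≡.trans (#A.to-cong (A.trans (g.to-cong (#A.strictlyInverseʳ _)) (g.strictlyInverseˡ _)))
                     (#A.strictlyInverseˡ i))
      (λ i → ≡.trans (#A.to-cong (A.trans (g.from-cong (#A.strictlyInverseʳ _)) (g.strictlyInverseʳ _)))
                     (#A.strictlyInverseˡ i))

module FiniteFieldProperties {s : ℕ} (E : FiniteField s) where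
  open FiniteField E hiding (zero)
  open import Algebra.Properties.Semiring.Exp semiring using (^-congˡ) renaming (_^_ to _^ᴱ_)
  open import Algebra.Properties.Semiring.Mult semiring using (×1-homo-*) renaming (_×_ to _×ᴱ_)
  open import Algebra.Properties.Ring ring using (+-cancelˡ; -‿distribʳ-*)
  open import Algebra.Properties.CommutativeSemigroup +-commutativeSemigroup using (xy∙z≈xz∙y)
  open import Algebra.Solver.Ring.NaturalCoefficients.Default commutativeSemiring using (solve; _:+_; _:*_; _:=_)
  open import Algebra.Properties.CommutativeMonoid.Sum +-commutativeMonoid using (sum; ∑-distrib-+; sum-replicate)
  open import Algebra.Properties.CommutativeMonoid.Sum *-commutativeMonoid as ∏ using () renaming (sum to product)
  open ≈-Reasoning setoid

  infix 4 _≟_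
  _≟_ : ∀ x y → Dec (x ≈ y)
  _≟_ = ≟-counted counting

  private module # = Inverse counting

  xy≈0⇒x≈0∨y≈0 : ∀ {x y} → x * y ≈ 0# → x ≈ 0# ⊎ y ≈ 0#
  xy≈0⇒x≈0∨y≈0 {x} {y} xy≈0 with x ≟ 0#
  ... | yes x≈0 = inj₁ x≈0
  ... | no  x≉0 with x⁻¹ , xx⁻¹≈1 ← inverse x x≉0 = inj₂ (begin
    y               ≈⟨ *-identityˡ y ⟨
    1# * y          ≈⟨ *-congʳ (trans (*-comm x⁻¹ x) xx⁻¹≈1) ⟨
    x⁻¹ * x * y     ≈⟨ *-assoc x⁻¹ x y ⟩
    x⁻¹ * (x * y)   ≈⟨ *-congˡ xy≈0 ⟩
    x⁻¹ * 0#        ≈⟨ zeroʳ x⁻¹ ⟩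
    0#              ∎)

  x^n≈0⇒x≈0 : ∀ {x} n → x ^ᴱ n ≈ 0# → x ≈ 0#
  x^n≈0⇒x≈0 zero    1≈0 = contradiction 1≈0 1≉0
  x^n≈0⇒x≈0 (suc n) eq  = [ (λ x≈0 → x≈0) , x^n≈0⇒x≈0 n ]′ (xy≈0⇒x≈0∨y≈0 eq)

  -- Translation by 1 permutes the field, hence fixes the sum of all its elements.
  s×1≈0 : s ×ᴱ 1# ≈ 0#
  s×1≈0 = sym (+-cancelˡ (sum #.from) _ _ (begin
    sum #.from + 0#                       ≈⟨ +-identityʳ _ ⟩
    sum #.from                            ≈⟨ sum-reindex +-commutativeMonoid counting +1 (λ x → x) (λ eq → eq) ⟩
    sum (λ i → #.from i + 1#)             ≈⟨ ∑-distrib-+ #.from (λ _ → 1#) ⟩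
    sum #.from + sum {s} (λ _ → 1#)       ≈⟨ +-congˡ (sum-replicate s) ⟩
    sum #.from + s ×ᴱ 1#                  ∎))
    where
    +1 : Inverse setoid setoid
    +1 = record
      { to = _+ 1# ; from = _+ (- 1#) ; to-cong = +-congʳ ; from-cong = +-congʳ
      ; inverse = (λ eq → trans (+-congʳ eq) (trans (+-assoc _ _ _) (trans (+-congˡ (-‿inverseˡ 1#)) (+-identityʳ _))))
                , (λ eq → trans (+-congʳ eq) (trans (+-assoc _ _ _) (trans (+-congˡ (-‿inverseʳ 1#)) (+-identityʳ _)))) }

  p^e×1≈0⇒p×1≈0 : ∀ {p} e → (p ^ e) ×ᴱ 1# ≈ 0# → p ×ᴱ 1# ≈ 0#
  p^e×1≈0⇒p×1≈0 zero eq = contradiction (trans (sym (+-identityʳ _)) eq) 1≉0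
  p^e×1≈0⇒p×1≈0 {p} (suc e) eq = [ (λ z → z) , p^e×1≈0⇒p×1≈0 e ]′
    (xy≈0⇒x≈0∨y≈0 (trans (sym (×1-homo-* p (p ^ e))) eq))

  private
    ifZero : Carrier → Carrier → Carrier → Carrier
    ifZero a b x with x ≟ 0#
    ... | yes _ = a
    ... | no  _ = b

    ifZero-yes : ∀ {a b x} → x ≈ 0# → ifZero a b x ≡ a
    ifZero-yes {x = x} x≈0 with x ≟ 0#
    ... | yes _  = ≡.refl
    ... | no x≉0 = contradiction x≈0 x≉0

    ifZero-no : ∀ {a b x} → ¬ (x ≈ 0#) → ifZero a b x ≡ b
    ifZero-no {x = x} x≉0 with x ≟ 0#
    ... | yes x≈0 = contradiction x≈0 x≉0
    ... | no _  = ≡.refl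

    product≉0 : ∀ {n} (v : Vector Carrier n) → (∀ i → ¬ (v i ≈ 0#)) → ¬ (product v ≈ 0#)
    product≉0 {zero}  v v≉0 eq = 1≉0 eq
    product≉0 {suc n} v v≉0 eq = [ v≉0 zero , product≉0 (tail v) (v≉0 ∘ suc) ]′ (xy≈0⇒x≈0∨y≈0 eq)

    x*product≈x^n : ∀ {n} x (v : Vector Carrier n) i → v i ≈ 1# → (∀ j → j ≢ i → v j ≈ x) → x * product v ≈ x ^ᴱ n
    x*product≈x^n {suc n} x v i vᵢ≈1 v≈x = *-congˡ (begin
      product v                     ≈⟨ ∏.sum-remove v ⟩
      v i * product (removeAt v i)  ≈⟨ *-cong vᵢ≈1 (∏.sum-cong-≋ λ j → v≈x _ (Fin.punchInᵢ≢i i j)) ⟩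
      1# * product {n} (λ _ → x)    ≈⟨ *-identityˡ _ ⟩
      product {n} (λ _ → x)         ≈⟨ ∏.sum-replicate n ⟩
      x ^ᴱ n                        ∎)

    *-inverse : ∀ x → ¬ (x ≈ 0#) → Inverse setoid setoid
    *-inverse x x≉0 with x⁻¹ , xx⁻¹≈1 ← inverse x x≉0 = record
      { to = x *_ ; from = x⁻¹ *_ ; to-cong = *-congˡ ; from-cong = *-congˡ
      ; inverse = (λ eq → trans (*-congˡ eq) (trans (sym (*-assoc _ _ _)) (trans (*-congʳ xx⁻¹≈1) (*-identityˡ _))))
                , (λ eq → trans (*-congˡ eq) (trans (sym (*-assoc _ _ _))
                    (trans (*-congʳ (trans (*-comm _ _) xx⁻¹≈1)) (*-identityˡ _)))) }

    -- The match on `inverse x x≉0` keeps `*-inverse` from reducing; repeating the match exposes its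
    -- underlying map.
    *-inverse-to : ∀ x (x≉0 : ¬ (x ≈ 0#)) y → Inverse.to (*-inverse x x≉0) y ≡ x * y
    *-inverse-to x x≉0 y with _ , _ ← inverse x x≉0 = ≡.refl

  -- For x ≉ 0, multiplication by x permutes the nonzero elements, hence fixes their product.
  x^s≈x : ∀ x → x ^ᴱ s ≈ x
  x^s≈x x with x ≟ 0#
  ... | yes x≈0 = trans (trans (^-congˡ s x≈0) (0^n≈0 (#.to 0#))) (sym x≈0)
    where
    0^n≈0 : ∀ {n} → Fin n → 0# ^ᴱ n ≈ 0#
    0^n≈0 {suc n} _ = zeroˡ _
  ... | no x≉0 = trans (sym (x*product≈x^n x (h ∘ #.from) (#.to 0#) (reflexive (ifZero-yes (#.strictlyInverseʳ 0#)))
      λ j j≢ → reflexive (ifZero-no λ eq → j≢ (≡.trans (≡.sym (#.strictlyInverseˡ j)) (#.to-cong eq)))))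
      (trans (*-congˡ ∏h≈1) (*-identityʳ x))
    where
    -- Both functions neutralise the zero element, so that products may run over the whole field.
    -- The product of `unit` is that of the nonzero elements. `h` is 1 at zero and `x` elsewhere, so
    -- its product is the (s - 1)-st power of `x`, written without subtraction in the exponent.
    unit h : Carrier → Carrier
    unit y = ifZero 1# y y
    h = ifZero 1# x

    unit-cong : ∀ {y z} → y ≈ z → unit y ≈ unit z
    unit-cong {y} {z} y≈z with y ≟ 0# | z ≟ 0#
    ... | yes _   | yes _   = refl
    ... | yes y≈0 | no z≉0  = contradiction (trans (sym y≈z) y≈0) z≉0
    ... | no y≉0  | yes z≈0 = contradiction (trans y≈z z≈0) y≉0
    ... | no _    | no _    = y≈z

    unit≉0 : ∀ y → ¬ (unit y ≈ 0#)
    unit≉0 y with y ≟ 0#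
    ... | yes _  = 1≉0
    ... | no y≉0 = y≉0

    unit-* : ∀ y → unit (x * y) ≈ h y * unit y
    unit-* y with y ≟ 0#
    ... | yes y≈0 = trans (reflexive (ifZero-yes (trans (*-congˡ y≈0) (zeroʳ x)))) (sym (*-identityˡ 1#))
    ... | no  y≉0 = reflexive (ifZero-no λ eq → [ x≉0 , y≉0 ]′ (xy≈0⇒x≈0∨y≈0 eq))

    P = product (unit ∘ #.from)

    ∏h*P≈P : product (h ∘ #.from) * P ≈ P
    ∏h*P≈P = begin
      product (h ∘ #.from) * P                        ≈⟨ ∏.∑-distrib-+ (h ∘ #.from) (unit ∘ #.from) ⟨
      product (λ i → h (#.from i) * unit (#.from i))  ≈⟨ ∏.sum-cong-≋ (λ i → unit-* (#.from i)) ⟨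
      product (λ i → unit (x * #.from i))             ≡⟨ ∏.sum-cong-≗ (λ i → cong unit (*-inverse-to x x≉0 (#.from i))) ⟨
      product (unit ∘ Inverse.to (*-inverse x x≉0) ∘ #.from)
        ≈⟨ sum-reindex *-commutativeMonoid counting (*-inverse x x≉0) unit unit-cong ⟨
      P                                               ∎

    ∏h≈1 : product (h ∘ #.from) ≈ 1#
    ∏h≈1 with P⁻¹ , PP⁻¹≈1 ← inverse P (product≉0 (unit ∘ #.from) (unit≉0 ∘ #.from)) = begin
      H              ≈⟨ *-identityʳ H ⟨
      H * 1#         ≈⟨ *-congˡ PP⁻¹≈1 ⟨
      H * (P * P⁻¹)  ≈⟨ *-assoc H P P⁻¹ ⟨
      H * P * P⁻¹    ≈⟨ *-congʳ ∏h*P≈P ⟩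
      P * P⁻¹        ≈⟨ PP⁻¹≈1 ⟩
      1#             ∎
      where H = product (h ∘ #.from)

  -- The degree is formal: the leading coefficient lc may vanish.
  data Poly (lc : Carrier) : ℕ → (Carrier → Carrier) → Set where
    const : ∀ {f} → (∀ x → f x ≈ lc) → Poly lc 0 f
    horner : ∀ {d f g} c → Poly lc d g → (∀ x → f x ≈ c + x * g x) → Poly lc (suc d) f

  -- The quotient in synthetic division is g + a h with h of lower degree than g; this shows that
  -- its leading coefficient is still that of g.
  Poly-+-lower : ∀ {lc lc′ d f g} a → Poly lc (suc d) f → Poly lc′ d g → Poly lc (suc d) (λ x → f x + a * g x)
  Poly-+-lower {lc′ = lc′} a (horner {g = f₁} c f₁-poly f≈) (const g≈) = horner (c + a * lc′) f₁-poly λ x → begin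
    _                              ≈⟨ +-cong (f≈ x) (*-congˡ (g≈ x)) ⟩
    c + x * f₁ x + a * lc′         ≈⟨ xy∙z≈xz∙y c (x * f₁ x) (a * lc′) ⟩
    c + a * lc′ + x * f₁ x         ∎
  Poly-+-lower {g = g} a (horner {f = f} {f₁} c f₁-poly f≈) (horner {g = g₁} c′ g₁-poly g≈) =
    horner (c + a * c′) (Poly-+-lower a f₁-poly g₁-poly) λ x → begin
    f x + a * g x                           ≈⟨ +-cong (f≈ x) (*-congˡ (g≈ x)) ⟩
    c + x * f₁ x + a * (c′ + x * g₁ x)      ≈⟨ solve 6 (λ c x f₁ a c′ g₁ → c :+ x :* f₁ :+ a :* (c′ :+ x :* g₁)
                                                 := c :+ a :* c′ :+ x :* (f₁ :+ a :* g₁)) refl c x (f₁ x) a c′ (g₁ x) ⟩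
    c + a * c′ + x * (f₁ x + a * g₁ x)      ∎

  -- Synthetic division; the identity f x − f a ≈ (x − a) h x is stated without subtraction.
  Poly-divide : ∀ {lc d f} a → Poly lc (suc d) f →
                ∃[ h ] (Poly lc d h × (∀ x → f x + a * h x ≈ f a + x * h x))
  Poly-divide {lc} {f = f} a (horner {g = g} c (const g≈) f≈) = (λ _ → lc) , const (λ _ → refl) , λ x → begin
    f x + a * lc          ≈⟨ +-congʳ (trans (f≈ x) (+-congˡ (*-congˡ (g≈ x)))) ⟩
    c + x * lc + a * lc   ≈⟨ xy∙z≈xz∙y c (x * lc) (a * lc) ⟩
    c + a * lc + x * lc   ≈⟨ +-congʳ (trans (f≈ a) (+-congˡ (*-congˡ (g≈ a)))) ⟨
    f a + x * lc          ∎
  Poly-divide {f = f} a (horner {g = g} c g-poly@(horner _ _ _) f≈)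
    with h , h-poly , g-divide ← Poly-divide a g-poly =
    (λ x → g x + a * h x) , Poly-+-lower a g-poly h-poly , λ x → begin
    f x + a * (g x + a * h x)            ≈⟨ +-congʳ (f≈ x) ⟩
    c + x * g x + a * (g x + a * h x)    ≈⟨ +-congˡ (*-congˡ (g-divide x)) ⟩
    c + x * g x + a * (g a + x * h x)    ≈⟨ solve 6 (λ c x a gx ga h → c :+ x :* gx :+ a :* (ga :+ x :* h)
                                             := c :+ a :* ga :+ x :* (gx :+ a :* h)) refl c x a (g x) (g a) (h x) ⟩
    c + a * g a + x * (g x + a * h x)    ≈⟨ +-congʳ (f≈ a) ⟨
    f a + x * (g x + a * h x)            ∎

  -- Dividing by the first root leaves a quotient that vanishes at all the others, since a nonzero
  -- value there could be cancelled and would identify two roots. The leading coefficient survives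
  -- each division, until a constant with a root remains.
  Poly-roots : ∀ {lc d f} → Poly lc d f → (r : Fin (suc d) → Carrier) → Injective _≡_ _≈_ r →
               (∀ i → f (r i) ≈ 0#) → lc ≈ 0#
  Poly-roots (const f≈) r r-inj root = trans (sym (f≈ _)) (root zero)
  Poly-roots {f = f} f-poly@(horner _ _ _) r r-inj root
    with h , h-poly , divide ← Poly-divide (r zero) f-poly =
    Poly-roots h-poly (r ∘ suc) (λ eq → Fin.suc-injective (r-inj eq)) h-root
    where
    h-root : ∀ i → h (r (suc i)) ≈ 0#
    h-root i with h (r (suc i)) ≟ 0#
    ... | yes eq = eq
    ... | no h≉0 = contradiction (r-inj (*-cancelʳ-≉0 h≉0 (begin
      r zero * hᵢ                       ≈⟨ +-identityˡ _ ⟨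
      0# + r zero * hᵢ                  ≈⟨ +-congʳ (root (suc i)) ⟨
      f (r (suc i)) + r zero * hᵢ       ≈⟨ divide (r (suc i)) ⟩
      f (r zero) + r (suc i) * hᵢ       ≈⟨ +-congʳ (root zero) ⟩
      0# + r (suc i) * hᵢ               ≈⟨ +-identityˡ _ ⟩
      r (suc i) * hᵢ                    ∎))) λ ()
      where
      hᵢ = h (r (suc i))
      *-cancelʳ-≉0 : ∀ {x y z} → ¬ (z ≈ 0#) → x * z ≈ y * z → x ≈ y
      *-cancelʳ-≉0 {x} {y} {z} z≉0 eq with z⁻¹ , zz⁻¹≈1 ← inverse z z≉0 = begin
        x               ≈⟨ *-identityʳ x ⟨
        x * 1#          ≈⟨ *-congˡ zz⁻¹≈1 ⟨
        x * (z * z⁻¹)   ≈⟨ *-assoc x z z⁻¹ ⟨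
        x * z * z⁻¹     ≈⟨ *-congʳ eq ⟩
        y * z * z⁻¹     ≈⟨ *-assoc y z z⁻¹ ⟩
        y * (z * z⁻¹)   ≈⟨ *-congˡ zz⁻¹≈1 ⟩
        y * 1#          ≈⟨ *-identityʳ y ⟩
        y               ∎

  x^n-poly : ∀ n → Poly 1# n (_^ᴱ n)
  x^n-poly zero    = const (λ _ → refl)
  x^n-poly (suc n) = horner 0# (x^n-poly n) (λ x → sym (+-identityˡ _))

  -- For n ≤ 1 the term - x would interfere with the leading coefficient.
  x^n-x-poly : ∀ n → 1 < n → Poly 1# n (λ x → x ^ᴱ n + - x)
  x^n-x-poly (suc zero) (s≤s ())
  x^n-x-poly (suc (suc n)) _ = horner 0# (horner (- 1#) (x^n-poly n) (λ x → refl)) λ x → begin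
    x * (x * x ^ᴱ n) + - x                 ≈⟨ +-comm _ _ ⟩
    - x + x * (x * x ^ᴱ n)                 ≈⟨ +-congʳ (trans (sym (-‿cong (*-identityʳ x))) (-‿distribʳ-* x 1#)) ⟩
    x * - 1# + x * (x * x ^ᴱ n)            ≈⟨ distribˡ x _ _ ⟨
    x * (- 1# + x * x ^ᴱ n)                ≈⟨ +-identityˡ _ ⟨
    0# + x * (- 1# + x * x ^ᴱ n)           ∎

  -- A root outside the list would be the (n + 1)-st root of a monic polynomial of degree n.
  x^n≈x-roots : ∀ {n} → 1 < n → (r : Fin n → Carrier) → Injective _≡_ _≈_ r → (∀ i → r i ^ᴱ n ≈ r i) →
                ∀ x → x ^ᴱ n ≈ x → ∃[ i ] (r i ≈ x)
  x^n≈x-roots {n} 1<n r r-inj r-root x x-root with Fin.any? (λ i → r i ≟ x)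
  ... | yes hit = hit
  ... | no miss = contradiction (Poly-roots (x^n-x-poly n 1<n) (x ∷ r) inj root) 1≉0
    where
    inj : Injective _≡_ _≈_ (x ∷ r)
    inj {zero}  {zero}  _  = ≡.refl
    inj {zero}  {suc j} eq = contradiction (j , sym eq) miss
    inj {suc i} {zero}  eq = contradiction (i , eq) miss
    inj {suc i} {suc j} eq = cong suc (r-inj eq)
    root : ∀ i → (x ∷ r) i ^ᴱ n + - (x ∷ r) i ≈ 0#
    root zero    = trans (+-congʳ x-root) (-‿inverseʳ x)
    root (suc i) = trans (+-congʳ (r-root i)) (-‿inverseʳ (r i))

-- Linear algebra over finite fields

module Combinations {R : Ring 0ℓ 0ℓ} (M : LeftModule R 0ℓ 0ℓ) where
  private module R = Ring R
  open LeftModule M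
  open LinearAlgebra M hiding (Subspace; module Subspace)
  open import Algebra.Properties.CommutativeMonoid.Sum +ᴹ-commutativeMonoid using (∑-distrib-+; sum-cong-≋; sum-replicate-zero)
  open import Algebra.Properties.Group +ᴹ-group using (identityˡ-unique)
  open import Algebra.Properties.Ring R using (x∙y⁻¹≈ε⇒x≈y)
  open ≈-Reasoning ≈ᴹ-setoid

  combination-∈ : ∀ (S : Subspace M) {t} a {b : Vector Carrierᴹ t} →
                  (∀ i → b i ∈ Subspace.Member S) → combination a b ∈ Subspace.Member S
  combination-∈ S {zero}  a b∈S = Subspace.0-closed S
  combination-∈ S {suc t} a b∈S =
    Subspace.+-closed S (Subspace.*ₗ-closed S (a zero) (b∈S zero)) (combination-∈ S (tail a) (b∈S ∘ suc))

  combination-congˡ : ∀ {t} {a a′ : Vector R.Carrier t} (b : Vector Carrierᴹ t) →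
                      (∀ i → a i R.≈ a′ i) → combination a b ≈ᴹ combination a′ b
  combination-congˡ b a≈a′ = sum-cong-≋ (λ i → *ₗ-congʳ (a≈a′ i))

  combination-0 : ∀ {t} (b : Vector Carrierᴹ t) → combination (λ _ → R.0#) b ≈ᴹ 0ᴹ
  combination-0 {t} b = ≈ᴹ-trans (sum-cong-≋ (λ i → *ₗ-zeroˡ (b i))) (sum-replicate-zero t)

  injective⇒independent : ∀ {t} {b : Vector Carrierᴹ t} →
    (∀ {a a′} → combination a b ≈ᴹ combination a′ b → ∀ i → a i R.≈ a′ i) → LinearlyIndependent b
  injective⇒independent {b = b} injective a comb≈0 =
    injective (≈ᴹ-trans comb≈0 (≈ᴹ-sym (combination-0 b)))

  independent⇒injective : ∀ {t} {b : Vector Carrierᴹ t} → LinearlyIndependent b →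
    ∀ {a a′} → combination a b ≈ᴹ combination a′ b → ∀ i → a i R.≈ a′ i
  independent⇒injective {b = b} independent {a} {a′} eq i =
    x∙y⁻¹≈ε⇒x≈y _ _ (independent (λ i → a i R.- a′ i) (identityˡ-unique _ (combination a′ b) (begin
      combination (λ i → a i R.- a′ i) b +ᴹ combination a′ b
        ≈⟨ ∑-distrib-+ (λ i → (a i R.- a′ i) *ₗ b i) (λ i → a′ i *ₗ b i) ⟨
      ∑ (λ i → (a i R.- a′ i) *ₗ b i +ᴹ a′ i *ₗ b i)
        ≈⟨ sum-cong-≋ (λ i → *ₗ-distribʳ (b i) _ _) ⟨
      combination (λ i → a i R.- a′ i R.+ a′ i) b
        ≈⟨ combination-congˡ b (λ i → R.trans (R.+-assoc _ _ _) (R.trans (R.+-congˡ (R.-‿inverseˡ _)) (R.+-identityʳ _))) ⟩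
      combination a b
        ≈⟨ eq ⟩
      combination a′ b ∎)) i)

∑-pointwise : ∀ {R : Ring 0ℓ 0ℓ} (M : LeftModule R 0ℓ 0ℓ) {n t} (w : Fin t → Fin n → LeftModule.Carrierᴹ M) j →
              LinearAlgebra.∑ (M ^ᴹ n) w j ≡ LinearAlgebra.∑ M (λ i → w i j)
∑-pointwise M {t = zero}  w j = ≡.refl
∑-pointwise M {t = suc t} w j = cong (LeftModule._+ᴹ_ M (w zero j)) (∑-pointwise M (w ∘ suc) j)

-- The shape of an echelon form: which of the n coordinates are pivots. Interleaving the two kinds
-- structurally avoids permuting coordinates to reach (I | A).
data Split : ℕ → ℕ → ℕ → Set where
  []     : Split 0 0 0
  pivot∷ : ∀ {d c n} → Split d c n → Split (suc d) c (suc n)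
  free∷  : ∀ {d c n} → Split d c n → Split d (suc c) (suc n)

Split-+ : ∀ {d c n} → Split d c n → d ℕ.+ c ≡ n
Split-+ []                 = ≡.refl
Split-+ (pivot∷ σ)         = cong suc (Split-+ σ)
Split-+ {d} {suc c} (free∷ σ) = ≡.trans (ℕ.+-suc d c) (cong suc (Split-+ σ))

pivots : ∀ {d c n} → Split d c n → Fin d → Fin n
pivots (pivot∷ σ) zero    = zero
pivots (pivot∷ σ) (suc i) = suc (pivots σ i)
pivots (free∷ σ)  i       = suc (pivots σ i)

frees : ∀ {d c n} → Split d c n → Fin c → Fin n
frees (free∷ σ)  zero    = zero
frees (free∷ σ)  (suc j) = suc (frees σ j)
frees (pivot∷ σ) j       = suc (frees σ j)

Split-cover : ∀ {d c n ℓ} (σ : Split d c n) {P : Pred (Fin n) ℓ} →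
              (∀ i → P (pivots σ i)) → (∀ j → P (frees σ j)) → ∀ k → P k
Split-cover (pivot∷ σ) p f zero    = p zero
Split-cover (pivot∷ σ) p f (suc k) = Split-cover σ (p ∘ suc) f k
Split-cover (free∷ σ)  p f zero    = f zero
Split-cover (free∷ σ)  p f (suc k) = Split-cover σ p (f ∘ suc) k

merge : ∀ {A : Set} {d c n} → Split d c n → Vector A d → Vector A c → Vector A n
merge (pivot∷ σ) x y zero    = x zero
merge (pivot∷ σ) x y (suc k) = merge σ (tail x) y k
merge (free∷ σ)  x y zero    = y zero
merge (free∷ σ)  x y (suc k) = merge σ x (tail y) k

merge-pivots : ∀ {A : Set} {d c n} (σ : Split d c n) (x : Vector A d) y i → merge σ x y (pivots σ i) ≡ x i
merge-pivots (pivot∷ σ) x y zero    = ≡.refl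
merge-pivots (pivot∷ σ) x y (suc i) = merge-pivots σ (tail x) y i
merge-pivots (free∷ σ)  x y i       = merge-pivots σ x (tail y) i

merge-frees : ∀ {A : Set} {d c n} (σ : Split d c n) (x : Vector A d) y j → merge σ x y (frees σ j) ≡ y j
merge-frees (pivot∷ σ) x y j       = merge-frees σ (tail x) y j
merge-frees (free∷ σ)  x y zero    = ≡.refl
merge-frees (free∷ σ)  x y (suc j) = merge-frees σ x (tail y) j

module FiniteLinearAlgebra {s : ℕ} (E : FiniteField s) where
  open FiniteField E hiding (zero)
  open FiniteFieldProperties E using (_≟_)
  open import Algebra.Properties.Semiring.Sum semiring public
    using (sum; sum-cong-≋; ∑-distrib-+; ∑-comm; *-distribˡ-sum; *-distribʳ-sum; sum-replicate-zero)
  open import Algebra.Solver.Ring.NaturalCoefficients.Default commutativeSemiring using (solve; _:+_; _:*_; _:=_)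
  open import Algebra.Properties.Ring ring using (+-cancelʳ; -‿distribˡ-*; -‿distribʳ-*)
  open import Algebra.Properties.CommutativeSemigroup *-commutativeSemigroup using (x∙yz≈y∙xz)
  open ≈-Reasoning setoid

  private
    E^ : ℕ → LeftModule ring 0ℓ 0ℓ
    E^ n = TensorUnit.leftModule {R = ring} ^ᴹ n

    module E^ n = LinearAlgebra (E^ n)

  infix 4 _≋_
  _≋_ : ∀ {n} → Vector Carrier n → Vector Carrier n → Set
  v ≋ w = ∀ i → v i ≈ w i

  1<s : 1 < s
  1<s = injective⇒≤ {A = ≡.setoid (Fin 2)} (Identity.inverse (≡.setoid (Fin 2))) counting (λ { zero → 0# ; (suc _) → 1# }) λ
    { {zero}     {zero}     _  → ≡.refl
    ; {zero}     {suc zero} eq → contradiction (sym eq) 1≉0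
    ; {suc zero} {zero}     eq → contradiction eq 1≉0
    ; {suc zero} {suc zero} _  → ≡.refl }

  infix 8 _·_
  _·_ : ∀ {n} → Vector Carrier n → Vector Carrier n → Carrier
  u · v = sum (λ i → u i * v i)

  ·-cong : ∀ {n} {u u′ v v′ : Vector Carrier n} → u ≋ u′ → v ≋ v′ → u · v ≈ u′ · v′
  ·-cong u≋u′ v≋v′ = sum-cong-≋ (λ i → *-cong (u≋u′ i) (v≋v′ i))

  ·-congˡ : ∀ {n} (u : Vector Carrier n) {v v′} → v ≋ v′ → u · v ≈ u · v′
  ·-congˡ u v≋v′ = ·-cong {u = u} (λ _ → refl) v≋v′

  ·-congʳ : ∀ {n} {u u′ : Vector Carrier n} v → u ≋ u′ → u · v ≈ u′ · v
  ·-congʳ v u≋u′ = ·-cong {v = v} u≋u′ (λ _ → refl)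

  ·-distribˡ : ∀ {n} (u v w : Vector Carrier n) → u · (λ i → v i + w i) ≈ u · v + u · w
  ·-distribˡ u v w = trans (sum-cong-≋ (λ i → distribˡ (u i) (v i) (w i)))
    (∑-distrib-+ (λ i → u i * v i) (λ i → u i * w i))

  ·-distribʳ : ∀ {n} (w u v : Vector Carrier n) → (λ i → u i + v i) · w ≈ u · w + v · w
  ·-distribʳ w u v = trans (sum-cong-≋ (λ i → distribʳ (w i) (u i) (v i)))
    (∑-distrib-+ (λ i → u i * w i) (λ i → v i * w i))

  ·-zeroʳ : ∀ {n} (u : Vector Carrier n) → u · (λ _ → 0#) ≈ 0#
  ·-zeroʳ {n} u = trans (sum-cong-≋ {n} (λ i → zeroʳ (u i))) (sum-replicate-zero n)

  ·-scaleˡ : ∀ {n} a (u v : Vector Carrier n) → (λ i → a * u i) · v ≈ a * (u · v)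
  ·-scaleˡ a u v = trans (sum-cong-≋ (λ i → *-assoc a (u i) (v i))) (sym (*-distribˡ-sum a (λ i → u i * v i)))

  ·-scaleʳ : ∀ {n} a (u v : Vector Carrier n) → u · (λ i → a * v i) ≈ a * (u · v)
  ·-scaleʳ a u v = trans (sum-cong-≋ (λ i → x∙yz≈y∙xz (u i) a (v i)))
                         (sym (*-distribˡ-sum a (λ i → u i * v i)))

  ·-assoc : ∀ {m n} (x : Vector Carrier m) (A : Fin m → Fin n → Carrier) (y : Vector Carrier n) →
            (λ j → x · (λ i → A i j)) · y ≈ x · (λ i → A i · y)
  ·-assoc x A y = begin
    sum (λ j → sum (λ i → x i * A i j) * y j)    ≈⟨ sum-cong-≋ (λ j → *-distribʳ-sum (y j) (λ i → x i * A i j)) ⟩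
    sum (λ j → sum (λ i → x i * A i j * y j))    ≈⟨ ∑-comm (λ j i → x i * A i j * y j) ⟩
    sum (λ i → sum (λ j → x i * A i j * y j))    ≈⟨ sum-cong-≋ (λ i → sum-cong-≋ (λ j → *-assoc (x i) (A i j) (y j))) ⟩
    sum (λ i → sum (λ j → x i * (A i j * y j)))  ≈⟨ sum-cong-≋ (λ i → *-distribˡ-sum (x i) (λ j → A i j * y j)) ⟨
    sum (λ i → x i * sum (λ j → A i j * y j))    ∎

  combination-pointwise : ∀ {n t} a (b : Vector (Vector Carrier n) t) j →
                          E^.combination n a b j ≡ a · (λ i → b i j)
  combination-pointwise a b j = ∑-pointwise {ring} TensorUnit.leftModule (λ i k → a i * b i k) j

  ·-comm : ∀ {n} (u v : Vector Carrier n) → u · v ≈ v · u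
  ·-comm u v = sum-cong-≋ (λ i → *-comm (u i) (v i))

  δ : ∀ {n} → Fin n → Vector Carrier n
  δ zero    zero    = 1#
  δ zero    (suc _) = 0#
  δ (suc _) zero    = 0#
  δ (suc i) (suc j) = δ i j

  δ-· : ∀ {n} i (v : Vector Carrier n) → δ i · v ≈ v i
  δ-· {suc n} zero    v = trans (+-cong (*-identityˡ _)
    (trans (sum-cong-≋ (λ i → zeroˡ (v (suc i)))) (sum-replicate-zero n))) (+-identityʳ _)
  δ-· {suc n} (suc i) v = trans (+-cong (zeroˡ _) (δ-· i (tail v))) (+-identityˡ _)

  δ-sym : ∀ {n} (i j : Fin n) → δ i j ≡ δ j i
  δ-sym zero    zero    = ≡.refl
  δ-sym zero    (suc j) = ≡.refl
  δ-sym (suc i) zero    = ≡.refl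
  δ-sym (suc i) (suc j) = δ-sym i j

  ·-δ : ∀ {n} (v : Vector Carrier n) j → v · (λ i → δ i j) ≈ v j
  ·-δ v j = trans (sum-cong-≋ λ i → trans (*-congˡ (reflexive (δ-sym i j))) (*-comm _ _)) (δ-· j v)

  ·-split : ∀ {d c n} (σ : Split d c n) (u v : Vector Carrier n) →
            u · v ≈ (u ∘ pivots σ) · (v ∘ pivots σ) + (u ∘ frees σ) · (v ∘ frees σ)
  ·-split []         u v = sym (+-identityˡ 0#)
  ·-split (pivot∷ σ) u v = trans (+-congˡ (·-split σ (tail u) (tail v))) (sym (+-assoc _ _ _))
  ·-split (free∷ σ)  u v = trans (+-congˡ (·-split σ (tail u) (tail v)))
    (solve 3 (λ x y z → x :+ (y :+ z) := y :+ (x :+ z)) refl _ _ _)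

  -- In coding terms `positions` is an information set and `point` the systematic encoder. Encoding
  -- the unit vectors then yields a basis.
  record Systematic {n} (S : Subspace (E^ n)) (d : ℕ) : Set where
    field
      positions   : Fin d → Fin n
      determined  : ∀ {v w} → v ∈ Subspace.Member S → w ∈ Subspace.Member S →
                    v ∘ positions ≋ w ∘ positions → v ≋ w
      point       : Vector Carrier d → Vector Carrier n
      point-∈     : ∀ x → point x ∈ Subspace.Member S
      point-coord : ∀ x → point x ∘ positions ≋ x

    hasDimension : E^.HasDimension n (Subspace.Member S) d
    hasDimension = b , record
      { inside      = b∈S
      ; independent = Combinations.injective⇒independent (E^ n) λ {a} {a′} eq i →
          trans (sym (comb-coord a i)) (trans (eq (positions i)) (comb-coord a′ i))
      ; spanning    = λ {v} v∈S → v ∘ positions ,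
          determined v∈S (Combinations.combination-∈ (E^ n) S (v ∘ positions) b∈S)
            (λ i → sym (comb-coord (v ∘ positions) i))
      }
      where
      b : Vector (Vector Carrier n) d
      b i = point (δ i)
      b∈S : ∀ i → b i ∈ Subspace.Member S
      b∈S i = point-∈ (δ i)
      comb-coord : ∀ a i → E^.combination n a b (positions i) ≈ a i
      comb-coord a i = begin
        E^.combination n a b (positions i)     ≡⟨ combination-pointwise a b (positions i) ⟩
        a · (λ k → point (δ k) (positions i))  ≈⟨ ·-congˡ a (λ k → point-coord (δ k) i) ⟩
        a · (λ k → δ k i)                      ≈⟨ ·-δ a i ⟩
        a i                                    ∎

  -- Up to the order of the coordinates, Graph is the row space of (I | A), and CoGraph its dual.
  module Split-equations {d c n} (σ : Split d c n) (A : Fin d → Fin c → Carrier) where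

    Graph : Pred (Vector Carrier n) 0ℓ
    Graph v = ∀ j → v (frees σ j) ≈ (v ∘ pivots σ) · (λ i → A i j)

    -- The pairings of `z` with the rows of (I | A). Their vanishing can be solved for the pivot
    -- coordinates, so `frees σ` is an information set for the dual.
    residue : Vector Carrier n → Vector Carrier d
    residue z i = z (pivots σ i) + A i · (z ∘ frees σ)

    CoGraph : Pred (Vector Carrier n) 0ℓ
    CoGraph z = ∀ i → residue z i ≈ 0#

    cograph : Subspace (E^ n)
    cograph = record
      { Member   = CoGraph
      ; ≈-closed = λ {x} {y} x≋y x∈ i → trans (sym (+-cong (x≋y _) (·-congˡ (A i) (x≋y ∘ frees σ)))) (x∈ i)
      ; 0-closed = λ i → trans (+-identityˡ _) (·-zeroʳ (A i))
      ; +-closed = λ {x} {y} x∈ y∈ i → begin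
          x (pivots σ i) + y (pivots σ i) + A i · (λ j → x (frees σ j) + y (frees σ j))
            ≈⟨ +-congˡ (·-distribˡ (A i) (x ∘ frees σ) (y ∘ frees σ)) ⟩
          x (pivots σ i) + y (pivots σ i) + (A i · (x ∘ frees σ) + A i · (y ∘ frees σ))
            ≈⟨ solve 4 (λ a b c d → a :+ b :+ (c :+ d) := a :+ c :+ (b :+ d)) refl _ _ _ _ ⟩
          residue x i + residue y i ≈⟨ +-cong (x∈ i) (y∈ i) ⟩
          0# + 0#                   ≈⟨ +-identityˡ 0# ⟩
          0#                        ∎
      ; *ₗ-closed = λ a {x} x∈ i → begin
          a * x (pivots σ i) + A i · (λ j → a * x (frees σ j))  ≈⟨ +-congˡ (·-scaleʳ a (A i) (x ∘ frees σ)) ⟩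
          a * x (pivots σ i) + a * (A i · (x ∘ frees σ))        ≈⟨ distribˡ a _ _ ⟨
          a * residue x i                                       ≈⟨ *-congˡ (x∈ i) ⟩
          a * 0#                                                ≈⟨ zeroʳ a ⟩
          0#                                                    ∎
      }

    graphPoint : Vector Carrier d → Vector Carrier n
    graphPoint x = merge σ x (λ j → x · (λ i → A i j))

    graphPoint-pivots : ∀ x → graphPoint x ∘ pivots σ ≋ x
    graphPoint-pivots x i = reflexive (merge-pivots σ x _ i)

    graphPoint-∈ : ∀ x → graphPoint x ∈ Graph
    graphPoint-∈ x j = trans (reflexive (merge-frees σ x _ j))
      (sym (·-congʳ (λ i → A i j) (graphPoint-pivots x)))

    cographPoint : Vector Carrier c → Vector Carrier n
    cographPoint y = merge σ (λ i → - (A i · y)) y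

    cographPoint-frees : ∀ y → cographPoint y ∘ frees σ ≋ y
    cographPoint-frees y j = reflexive (merge-frees σ _ y j)

    cographPoint-∈ : ∀ y → cographPoint y ∈ CoGraph
    cographPoint-∈ y i = trans (+-cong (reflexive (merge-pivots σ _ y i)) (·-congˡ (A i) (cographPoint-frees y)))
      (-‿inverseˡ _)

    graph-determined : ∀ {v w} → v ∈ Graph → w ∈ Graph → v ∘ pivots σ ≋ w ∘ pivots σ → v ≋ w
    graph-determined v∈ w∈ v≋w = Split-cover σ v≋w λ j →
      trans (v∈ j) (trans (·-congʳ (λ i → A i j) v≋w) (sym (w∈ j)))

    cograph-determined : ∀ {v w} → v ∈ CoGraph → w ∈ CoGraph → v ∘ frees σ ≋ w ∘ frees σ → v ≋ w
    cograph-determined {v} {w} v∈ w∈ v≋w = Split-cover σ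
      (λ i → +-cancelʳ (A i · (w ∘ frees σ)) _ _
        (trans (trans (+-congˡ (sym (·-congˡ (A i) v≋w))) (v∈ i)) (sym (w∈ i)))) v≋w

    cograph-systematic : Systematic cograph c
    cograph-systematic = record
      { positions = frees σ ; determined = cograph-determined ; point = cographPoint
      ; point-∈ = cographPoint-∈ ; point-coord = cographPoint-frees }

    graph-· : ∀ {v} z → v ∈ Graph → v · z ≈ (v ∘ pivots σ) · residue z
    graph-· {v} z v∈ = begin
      v · z
        ≈⟨ ·-split σ v z ⟩
      (v ∘ pivots σ) · (z ∘ pivots σ) + (v ∘ frees σ) · (z ∘ frees σ)
        ≈⟨ +-congˡ (trans (·-congʳ (z ∘ frees σ) v∈) (·-assoc (v ∘ pivots σ) A (z ∘ frees σ))) ⟩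
      (v ∘ pivots σ) · (z ∘ pivots σ) + (v ∘ pivots σ) · (λ i → A i · (z ∘ frees σ))
        ≈⟨ ·-distribˡ (v ∘ pivots σ) (z ∘ pivots σ) _ ⟨
      (v ∘ pivots σ) · residue z ∎

    graph⊥cograph : ∀ {v z} → v ∈ Graph → z ∈ CoGraph → v · z ≈ 0#
    graph⊥cograph {v} {z} v∈ z∈ = trans (graph-· z v∈)
      (trans (·-congˡ (v ∘ pivots σ) z∈) (·-zeroʳ (v ∘ pivots σ)))

    ⊥graph⇒cograph : ∀ {z} → (∀ i → graphPoint (δ i) · z ≈ 0#) → z ∈ CoGraph
    ⊥graph⇒cograph {z} ⊥z i = begin
      residue z i                                 ≈⟨ δ-· i (residue z) ⟨
      δ i · residue z                             ≈⟨ ·-congʳ (residue z) (graphPoint-pivots (δ i)) ⟨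
      (graphPoint (δ i) ∘ pivots σ) · residue z   ≈⟨ graph-· z (graphPoint-∈ (δ i)) ⟨
      graphPoint (δ i) · z                        ≈⟨ ⊥z i ⟩
      0#                                          ∎

  record GraphForm {n} (S : Subspace (E^ n)) : Set where
    field
      {d c}  : ℕ
      σ      : Split d c n
      A      : Fin d → Fin c → Carrier
      equals : Subspace.Member S ≐ Split-equations.Graph σ A
    open Split-equations σ A public

    systematic : Systematic S d
    systematic = record
      { positions = pivots σ ; determined = λ v∈ w∈ → graph-determined (proj₁ equals v∈) (proj₁ equals w∈)
      ; point = graphPoint ; point-∈ = λ x → proj₂ equals (graphPoint-∈ x) ; point-coord = graphPoint-pivots }

  -- Gaussian elimination by induction on the length. `S′` consists of the members that start with
  -- 0; either these are all of `S`, or `S` is spanned by them and one vector `u` with first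
  -- coordinate 1. The result is the reduced form, whose rows have entries 0 and 1 at the pivots;
  -- descent to F depends on this.
  graphForm : ∀ {n} (S : Subspace (E^ n)) → Decidable (Subspace.Member S) → GraphForm S
  graphForm {zero}  S S? = record
    { σ = [] ; A = λ () ; equals = (λ _ ()) , λ _ → Subspace.≈-closed S (λ ()) (Subspace.0-closed S) }
  graphForm {suc n} S S? = extend (graphForm S′ (λ w → S? (0# ∷ w)))
    where
    open Subspace S

    ∷-closed : ∀ {v w} → v zero ≈ 0# → tail v ≋ w → v ∈ Member → 0# ∷ w ∈ Member
    ∷-closed v₀≈0 v≋w = ≈-closed λ { zero → v₀≈0 ; (suc i) → v≋w i }

    S′ : Subspace (E^ n)
    S′ = record
      { Member    = λ w → 0# ∷ w ∈ Member
      ; ≈-closed  = λ x≋y → ∷-closed refl x≋y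
      ; 0-closed  = ∷-closed refl (λ _ → refl) 0-closed
      ; +-closed  = λ x∈ y∈ → ∷-closed (+-identityˡ 0#) (λ _ → refl) (+-closed x∈ y∈)
      ; *ₗ-closed = λ a x∈ → ∷-closed (zeroʳ a) (λ _ → refl) (*ₗ-closed a x∈)
      }

    extend : GraphForm S′ → GraphForm S
    extend record { d = d ; c = c ; σ = σ ; A = A ; equals = ⊆Graph , Graph⊆ }
      with finite-any? (vectorCounted counting (suc n)) {P = λ v → v ∈ Member × ¬ (v zero ≈ 0#)}
             (λ x≋y (x∈ , x₀≉0) → ≈-closed x≋y x∈ , λ y₀≈0 → x₀≉0 (trans (x≋y zero) y₀≈0))
             (λ v → S? v ×-dec ¬? (v zero ≟ 0#))
    ... | no ∄pivot = record
      { σ = free∷ σ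
      ; A = λ i → 0# ∷ A i
      ; equals = (λ { {v} v∈ zero    → trans (v₀≈0 v∈) (sym (·-zeroʳ (v ∘ pivots (free∷ σ))))
                    ; v∈ (suc j) → ⊆Graph (∷-closed (v₀≈0 v∈) (λ _ → refl) v∈) j })
               , (λ {v} v∈ → ≈-closed (λ { zero → sym (trans (v∈ zero) (·-zeroʳ (v ∘ pivots (free∷ σ)))) ; (suc i) → refl })
                    (Graph⊆ (v∈ ∘ suc)))
      }
      where
      v₀≈0 : ∀ {v} → v ∈ Member → v zero ≈ 0#
      v₀≈0 {v} v∈ with v zero ≟ 0#
      ... | yes eq = eq
      ... | no v₀≉0 = contradiction (v , v∈ , v₀≉0) ∄pivot
    ... | yes (v , v∈ , v₀≉0) with v₀⁻¹ , v₀v₀⁻¹≈1 ← inverse (v zero) v₀≉0 = record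
      { σ = pivot∷ σ
      -- `u` need not vanish at the later pivots. Subtracting the corresponding multiples of the
      -- rows already found clears those entries, and this is what remains at the free positions.
      ; A = (λ j → u (suc (frees σ j)) - (tail u ∘ pivots σ) · col j) ∷ A
      ; equals = (λ {x} x∈ j → to (trans (⊆Graph (reduce-∈ x∈) j) (reduce-· x j)))
               , (λ {x} x∈ → unreduce-∈ (Graph⊆ (λ j → trans (from (x∈ j)) (sym (reduce-· x j)))))
      }
      where
      u : Vector Carrier (suc n)
      u i = v₀⁻¹ * v i

      u∈ : u ∈ Member
      u∈ = *ₗ-closed v₀⁻¹ v∈

      u₀≈1 : u zero ≈ 1#
      u₀≈1 = trans (*-comm _ _) v₀v₀⁻¹≈1

      col : Fin c → Vector Carrier d
      col j i = A i j

      reduce : Vector Carrier (suc n) → Vector Carrier n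
      reduce x i = x (suc i) + (- x zero) * u (suc i)

      cancel : ∀ y a b → y + (- a) * b + a * b ≈ y
      cancel y a b = begin
        y + (- a) * b + a * b    ≈⟨ +-assoc y _ _ ⟩
        y + ((- a) * b + a * b)  ≈⟨ +-congˡ (distribʳ b (- a) a) ⟨
        y + (- a + a) * b        ≈⟨ +-congˡ (trans (*-congʳ (-‿inverseˡ a)) (zeroˡ b)) ⟩
        y + 0#                   ≈⟨ +-identityʳ y ⟩
        y                        ∎

      -‿swap-* : ∀ a e → (- a) * e ≈ a * (- e)
      -‿swap-* a e = trans (sym (-‿distribˡ-* a e)) (-‿distribʳ-* a e)

      reduce-∈ : ∀ {x} → x ∈ Member → 0# ∷ reduce x ∈ Member
      reduce-∈ {x} x∈ = ∷-closed
        (trans (+-congˡ (trans (*-congˡ u₀≈1) (*-identityʳ _))) (-‿inverseʳ _)) (λ _ → refl)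
        (+-closed x∈ (*ₗ-closed (- x zero) u∈))

      unreduce-∈ : ∀ {x} → 0# ∷ reduce x ∈ Member → x ∈ Member
      unreduce-∈ {x} rx∈ = ≈-closed
        (λ { zero    → trans (+-identityˡ _) (trans (*-congˡ u₀≈1) (*-identityʳ _))
           ; (suc i) → cancel (x (suc i)) (x zero) (u (suc i)) })
        (+-closed rx∈ (*ₗ-closed (x zero) u∈))

      reduce-· : ∀ x j → (reduce x ∘ pivots σ) · col j ≈
                         (tail x ∘ pivots σ) · col j + (- x zero) * ((tail u ∘ pivots σ) · col j)
      reduce-· x j = trans (·-distribʳ (col j) (tail x ∘ pivots σ) (λ i → (- x zero) * u (suc (pivots σ i))))
        (+-congˡ (·-scaleˡ (- x zero) (tail u ∘ pivots σ) (col j)))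

      -- `to` and `from` translate between the graph equation of `reduce x`, in the form produced by
      -- `reduce-·`, and the equation for `x` itself with the new row of the matrix.
      to : ∀ {y a b d e} → y + (- a) * b ≈ d + (- a) * e → y ≈ a * (b - e) + d
      to {y} {a} {b} {d} {e} eq = begin
        y                          ≈⟨ cancel y a b ⟨
        y + (- a) * b + a * b      ≈⟨ +-congʳ eq ⟩
        d + (- a) * e + a * b      ≈⟨ +-congʳ (+-congˡ (-‿swap-* a e)) ⟩
        d + a * (- e) + a * b      ≈⟨ solve 4 (λ d a n b → d :+ a :* n :+ a :* b := a :* (b :+ n) :+ d) refl d a (- e) b ⟩
        a * (b - e) + d            ∎

      from : ∀ {y a b d e} → y ≈ a * (b - e) + d → y + (- a) * b ≈ d + (- a) * e
      from {y} {a} {b} {d} {e} eq = begin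
        y + (- a) * b                  ≈⟨ +-congʳ eq ⟩
        a * (b - e) + d + (- a) * b
          ≈⟨ solve 5 (λ d a n b m → a :* (b :+ n) :+ d :+ m :* b := d :+ a :* n :+ m :* b :+ a :* b) refl d a (- e) b (- a) ⟩
        d + a * (- e) + (- a) * b + a * b   ≈⟨ cancel _ a b ⟩
        d + a * (- e)                  ≈⟨ +-congˡ (-‿swap-* a e) ⟨
        d + (- a) * e                  ∎

^-cancelʳ-≤ : ∀ {s d e} → 1 < s → s ^ d ≤ s ^ e → d ≤ e
^-cancelʳ-≤ {s} {d} {e} 1<s s^d≤s^e = ℕ.≮⇒≥ λ e<d → ℕ.<⇒≱ (ℕ.^-monoʳ-< s 1<s e<d) s^d≤s^e

-- Dimension by counting

module Dimension {s : ℕ} (E : FiniteField s) (M : LeftModule (FiniteField.ring E) 0ℓ 0ℓ) where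
  open FiniteField E using (counting)
  open LinearAlgebra M hiding (Subspace; module Subspace)
  open LeftModule M

  Span? : (∀ x y → Dec (x ≈ᴹ y)) → ∀ {t} (b : Vector Carrierᴹ t) → Decidable (Span b)
  Span? _≟_ {t} b x = finite-any? (vectorCounted counting t)
    (λ a≋a′ x≈ → ≈ᴹ-trans x≈ (Combinations.combination-congˡ M b a≋a′)) (λ a → x ≟ combination a b)

  -- Counting takes the place of the exchange lemma: re-expressing combinations of one basis in
  -- coordinates of the other is injective, so s^d ≤ s^e. For S = T, used in both directions, it
  -- gives uniqueness of dimension.
  dimension-mono : ∀ {S : Pred Carrierᴹ 0ℓ} (T : Subspace M) {d e} → S ⊆ Subspace.Member T →
                   HasDimension S d → HasDimension (Subspace.Member T) e → d ≤ e
  dimension-mono {S} T S⊆T (b , b-basis) (b′ , b′-basis) =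
    ^-cancelʳ-≤ (FiniteLinearAlgebra.1<s E) (injective⇒≤ (vectorCounted counting _) (vectorCounted counting _)
      (λ a → proj₁ (coordinates a))
      λ {a} {a′} eq → Combinations.independent⇒injective M (B.independent)
        (≈ᴹ-trans (proj₂ (coordinates a))
          (≈ᴹ-trans (Combinations.combination-congˡ M b′ eq) (≈ᴹ-sym (proj₂ (coordinates a′))))))
    where
    module B = IsBasis b-basis
    module B′ = IsBasis b′-basis
    coordinates : ∀ a → combination a b ∈ Span b′
    coordinates a = B′.spanning (Combinations.combination-∈ M T a (λ i → S⊆T (B.inside i)))

-- The extension K of F

module Frobenius {q m : ℕ} (q-primePower : IsPrimePower q) (F : FiniteField q) (K : FiniteField (q ^ m))
                 (ι : RingHomomorphism (FiniteField.rawRing F) (FiniteField.rawRing K)) where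
  private
    module F where
      open FiniteField F public
      open FiniteFieldProperties F public
      open FiniteLinearAlgebra F public
      open import Algebra.Properties.Semiring.Exp (FiniteField.semiring F) public using () renaming (_^_ to _^ᴱ_)
    module ι = RingHomomorphism ι
  open FiniteField K hiding (zero; _-_)
  open FiniteFieldProperties K
  open FiniteLinearAlgebra K
  open ≈-Reasoning setoid
  open import Algebra.Properties.Semiring.Exp semiring using (^-congˡ) renaming (_^_ to _^ᴱ_)
  open import Algebra.Properties.CommutativeSemiring.Exp commutativeSemiring using (^-distrib-*)
  open import Algebra.Properties.Ring ring using (+-identityˡ-unique; x∙y⁻¹≈ε⇒x≈y)

  frob : Carrier → Carrier
  frob x = x ^ᴱ q

  frob-cong : ∀ {x y} → x ≈ y → frob x ≈ frob y
  frob-cong = ^-congˡ q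

  frob-+ : ∀ x y → frob (x + y) ≈ frob x + frob y
  frob-+ x y = additive q-primePower
    where
    open import Algebra.Properties.Semiring.Mult semiring using () renaming (_×_ to _×ᴱ_)
    additive : IsPrimePower q → frob (x + y) ≈ frob x + frob y
    -- The size of K is p to the power (e + 1) m and annihilates 1; as K has no zero divisors, `p`
    -- already annihilates 1. Raising to the power q is then an iterate of the additive map x ↦ x^p.
    additive (p , e , p-prime , q≡p^e) =
      ≡.subst (λ t → (x + y) ^ᴱ t ≈ x ^ᴱ t + y ^ᴱ t) (≡.sym q≡p^e)
        (PrimeCharacteristic.^p^e-distrib-+ commutativeSemiring p-prime
          (p^e×1≈0⇒p×1≈0 (suc e ℕ.* m)
            (≡.subst (λ s → s ×ᴱ 1# ≈ 0#) (≡.trans (cong (_^ m) q≡p^e) (ℕ.^-*-assoc p (suc e) m)) s×1≈0))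
          (suc e) x y)

  frob-* : ∀ x y → frob (x * y) ≈ frob x * frob y
  frob-* x y = ^-distrib-* x y q

  frob-0 : frob 0# ≈ 0#
  frob-0 = +-identityˡ-unique _ _ (trans (sym (frob-+ 0# 0#)) (frob-cong (+-identityˡ 0#)))

  frob-injective : Injective _≈_ _≈_ frob
  frob-injective {x} {y} eq = x∙y⁻¹≈ε⇒x≈y x y (x^n≈0⇒x≈0 q (+-identityˡ-unique _ (frob y) (begin
    frob (x + - y) + frob y   ≈⟨ frob-+ _ y ⟨
    frob (x + - y + y)        ≈⟨ frob-cong (trans (+-assoc x _ y) (trans (+-congˡ (-‿inverseˡ y)) (+-identityʳ x))) ⟩
    frob x                    ≈⟨ eq ⟩
    frob y                    ∎)))

  frob-surjective : StrictlySurjective _≈_ frob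
  frob-surjective = injective⇒surjective counting counting frob frob-injective ≡.refl

  frob-sum : ∀ {t} (v : Vector Carrier t) → frob (sum v) ≈ sum (frob ∘ v)
  frob-sum {zero}  v = frob-0
  frob-sum {suc t} v = trans (frob-+ _ _) (+-congˡ (frob-sum (tail v)))

  frob-· : ∀ {t} (u v : Vector Carrier t) → frob (u · v) ≈ (frob ∘ u) · (frob ∘ v)
  frob-· u v = trans (frob-sum (λ i → u i * v i)) (sum-cong-≋ (λ i → frob-* (u i) (v i)))

  ι-sum : ∀ {t} (v : Vector F.Carrier t) → ι.⟦ F.sum v ⟧ ≈ sum (ι.⟦_⟧ ∘ v)
  ι-sum {zero}  v = ι.0#-homo
  ι-sum {suc t} v = trans (ι.+-homo _ _) (+-congˡ (ι-sum (tail v)))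

  ι-· : ∀ {t} (u v : Vector F.Carrier t) → ι.⟦ u F.· v ⟧ ≈ (ι.⟦_⟧ ∘ u) · (ι.⟦_⟧ ∘ v)
  ι-· u v = trans (ι-sum (λ i → u i F.* v i)) (sum-cong-≋ (λ i → ι.*-homo (u i) (v i)))

  ι-^ : ∀ x t → ι.⟦ x F.^ᴱ t ⟧ ≈ ι.⟦ x ⟧ ^ᴱ t
  ι-^ x zero    = ι.1#-homo
  ι-^ x (suc t) = trans (ι.*-homo _ _) (*-congˡ (ι-^ x t))

  frob-ι : ∀ a → frob ι.⟦ a ⟧ ≈ ι.⟦ a ⟧
  frob-ι a = trans (sym (ι-^ a q)) (ι.⟦⟧-cong (F.x^s≈x a))

  ι-injective : Injective F._≈_ _≈_ ι.⟦_⟧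
  ι-injective {x} {y} eq with (x F.- y) F.≟ F.0#
  ... | yes x-y≈0 = Fx∙y⁻¹≈ε⇒x≈y x y x-y≈0
    where open import Algebra.Properties.Ring F.ring using () renaming (x∙y⁻¹≈ε⇒x≈y to Fx∙y⁻¹≈ε⇒x≈y)
  ... | no x-y≉0 with z , [x-y]z≈1 ← F.inverse _ x-y≉0 = contradiction (begin
    1#                               ≈⟨ ι.1#-homo ⟨
    ι.⟦ F.1# ⟧                       ≈⟨ ι.⟦⟧-cong [x-y]z≈1 ⟨
    ι.⟦ (x F.- y) F.* z ⟧            ≈⟨ ι.*-homo _ z ⟩
    ι.⟦ x F.- y ⟧ * ι.⟦ z ⟧
      ≈⟨ *-congʳ (trans (ι.+-homo x (F.- y)) (trans (+-congʳ eq) (sym (ι.+-homo y (F.- y))))) ⟩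
    ι.⟦ y F.- y ⟧ * ι.⟦ z ⟧          ≈⟨ *-congʳ (trans (ι.⟦⟧-cong (F.-‿inverseʳ y)) ι.0#-homo) ⟩
    0# * ι.⟦ z ⟧                     ≈⟨ zeroˡ _ ⟩
    0#                               ∎) 1≉0

  -- The images of the q elements of F are distinct and fixed, so they exhaust the roots of x^q - x.
  frob-fixed : ∀ x → frob x ≈ x → ∃[ a ] (ι.⟦ a ⟧ ≈ x)
  frob-fixed x x-fixed with i , eq ← x^n≈x-roots F.1<s (ι.⟦_⟧ ∘ Inverse.from F.counting)
      (λ {i} {j} eq → ≡.trans (≡.sym (Inverse.strictlyInverseˡ F.counting i))
        (≡.trans (Inverse.to-cong F.counting (ι-injective eq)) (Inverse.strictlyInverseˡ F.counting j)))
      (λ i → frob-ι _) x x-fixed = _ , eq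

-- Codes and systems

module Correspondence
  {q m n k : ℕ} .{{_ : NonZero m}} (q-primePower : IsPrimePower q)
  (F : FiniteField q) (K : FiniteField (q ^ m))
  (ι : RingHomomorphism (FiniteField.rawRing F) (FiniteField.rawRing K))
  (C : RankMetric.Code {q} {m} F K ι n k) (𝒰 : RankMetric.System {q} {m} F K ι n k)
  (G : Fin k → Fin n → FiniteField.Carrier K)
  (G-generates : RankMetric.IsGeneratorMatrix {q} {m} F K ι G C)
  (𝒰≐columns : RankMetric.System.Member 𝒰 ≐
                LinearAlgebra.Span (RankMetric.K^_/F {q} {m} F K ι k) (λ j i → G i j))
  where
  private
    module F where
      open FiniteField F public
      open FiniteFieldProperties F public
      open FiniteLinearAlgebra F public
    module ι = RingHomomorphism ι
    module C = RankMetric.Code C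
    module 𝒰 = RankMetric.System 𝒰
  open RankMetric {q} {m} F K ι hiding (module Code; module System)
  open FiniteField K hiding (zero; _-_)
  open FiniteFieldProperties K
  open FiniteLinearAlgebra K
  open Frobenius {q} {m} q-primePower F K ι
  open ≈-Reasoning setoid
  private
    module K^ n = LinearAlgebra (K^ n)
    module K^/F n = LinearAlgebra (K^ n /F)
    module G = LinearAlgebra.IsBasis G-generates

  ≋? : ∀ {t} (v w : Vector Carrier t) → Dec (v ≋ w)
  ≋? v w = Fin.all? (λ i → v i ≟ w i)

  codeword : Vector Carrier k → Vector Carrier n
  codeword x j = x · (λ i → G i j)

  combination-G : ∀ x → K^.combination n x G ≋ codeword x
  combination-G x j = reflexive (combination-pointwise x G j)

  codeword-cong : ∀ {x y} → x ≋ y → codeword x ≋ codeword y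
  codeword-cong x≋y j = ·-congʳ (λ i → G i j) x≋y

  codeword-injective : ∀ {x y} → codeword x ≋ codeword y → x ≋ y
  codeword-injective {x} {y} eq = Combinations.independent⇒injective (K^ n) G.independent
    (λ j → trans (combination-G x j) (trans (eq j) (sym (combination-G y j))))

  codeword-∈ : ∀ x → codeword x ∈ C.Member
  codeword-∈ x = C.≈-closed (combination-G x) (Combinations.combination-∈ (K^ n) C.subspace x G.inside)

  codeword-surjective : ∀ {v} → v ∈ C.Member → ∃[ x ] v ≋ codeword x
  codeword-surjective v∈C with x , v≋ ← G.spanning v∈C = x , λ j → trans (v≋ j) (combination-G x j)

  point : Vector F.Carrier n → Vector Carrier k
  point u i = G i · (ι.⟦_⟧ ∘ u)

  combination-columns : ∀ u → K^/F.combination k u (λ j i → G i j) ≋ point u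
  combination-columns u i = trans (reflexive (∑-pointwise {ring} TensorUnit.leftModule (λ j l → ι.⟦ u j ⟧ * G l j) i))
    (·-comm (ι.⟦_⟧ ∘ u) (G i))

  codeword·ι : ∀ x u → codeword x · (ι.⟦_⟧ ∘ u) ≈ x · point u
  codeword·ι x u = ·-assoc x G (ι.⟦_⟧ ∘ u)

  point-∈ : ∀ u → point u ∈ 𝒰.Member
  point-∈ u = proj₂ 𝒰≐columns (u , λ i → sym (combination-columns u i))

  point-surjective : ∀ {z} → z ∈ 𝒰.Member → ∃[ u ] z ≋ point u
  point-surjective z∈𝒰 with u , z≋ ← proj₁ 𝒰≐columns z∈𝒰 = u , λ i → trans (z≋ i) (combination-columns u i)

  point-cong : ∀ {u v} → u F.≋ v → point u ≋ point v
  point-cong u≋v i = ·-congˡ (G i) (ι.⟦⟧-cong ∘ u≋v)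

  -- The n columns of `G` generate a space of F-dimension n, so they must be independent.
  -- Concretely, u ↦ (coordinates of Gu in a basis of 𝒰) is a surjective map from the finite set F^n
  -- to itself.
  point-injective : ∀ {u v} → point u ≋ point v → u F.≋ v
  point-injective {u} {v} eq = surjective⇒injective (vectorCounted F.counting n) coordinates
    (λ u≋v → same-coordinates (point-cong u≋v)) coordinates-surjective (same-coordinates eq)
    where
    b = proj₁ 𝒰.dimension
    module B = LinearAlgebra.IsBasis (proj₂ 𝒰.dimension)

    coordinates : Vector F.Carrier n → Vector F.Carrier n
    coordinates u = proj₁ (B.spanning (point-∈ u))

    coordinates-≋ : ∀ u → point u ≋ K^/F.combination k (coordinates u) b
    coordinates-≋ u = proj₂ (B.spanning (point-∈ u))

    b-injective : ∀ {a a′} → K^/F.combination k a b ≋ K^/F.combination k a′ b → a F.≋ a′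
    b-injective = Combinations.independent⇒injective (K^ k /F) B.independent

    same-coordinates : ∀ {u v} → point u ≋ point v → coordinates u F.≋ coordinates v
    same-coordinates {u} {v} eq = b-injective λ i →
      trans (sym (coordinates-≋ u i)) (trans (eq i) (coordinates-≋ v i))

    coordinates-surjective : ∀ a → ∃[ u ] coordinates u F.≋ a
    coordinates-surjective a
      with u , eq ← point-surjective (Combinations.combination-∈ (K^ k /F) 𝒰.subspace a B.inside) =
      u , b-injective (λ i → trans (sym (coordinates-≋ u i)) (sym (eq i)))

  𝒰? : Decidable 𝒰.Member
  𝒰? z = map′ (proj₂ 𝒰≐columns) (proj₁ 𝒰≐columns) (Dimension.Span? F (K^ k /F) ≋? (λ j i → G i j) z)

  -- The largest K-subspace of the system

  core : Subspace (K^ k)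
  core = record
    { Member    = λ x → ∀ a → (λ i → a * x i) ∈ 𝒰.Member
    ; ≈-closed  = λ x≋y x∈ a → 𝒰.≈-closed (λ i → *-congˡ (x≋y i)) (x∈ a)
    ; 0-closed  = λ a → 𝒰.≈-closed (λ _ → sym (zeroʳ a)) 𝒰.0-closed
    ; +-closed  = λ x∈ y∈ a → 𝒰.≈-closed (λ _ → sym (distribˡ a _ _)) (𝒰.+-closed (x∈ a) (y∈ a))
    ; *ₗ-closed = λ b x∈ a → 𝒰.≈-closed (λ _ → *-assoc a b _) (x∈ (a * b))
    }

  private module core = Subspace core

  core⊆𝒰 : core.Member ⊆ 𝒰.Member
  core⊆𝒰 x∈ = 𝒰.≈-closed (λ _ → *-identityˡ _) (x∈ 1#)

  core-largest : (H : Subspace (K^ k)) → Subspace.Member H ⊆ 𝒰.Member → Subspace.Member H ⊆ core.Member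
  core-largest H H⊆𝒰 x∈ a = H⊆𝒰 (Subspace.*ₗ-closed H a x∈)

  core? : Decidable core.Member
  core? x = finite-all? counting (λ a≈b → 𝒰.≈-closed (λ _ → *-congʳ a≈b)) (λ a → 𝒰? (λ i → a * x i))

  private module core-form = GraphForm (graphForm core core?)

  ℓ : ℕ
  ℓ = core-form.d

  ℓ-maximal : (H : Subspace (K^ k)) → Subspace.Member H ⊆ 𝒰.Member → ∀ {d} →
              K^.HasDimension k (Subspace.Member H) d → d ≤ ℓ
  ℓ-maximal H H⊆𝒰 H-dim = Dimension.dimension-mono K (K^ k) core (core-largest H H⊆𝒰) H-dim
    (Systematic.hasDimension core-form.systematic)

  ℓ-isLinearityIndex : IsLinearityIndex 𝒰 ℓ
  ℓ-isLinearityIndex = (core , core⊆𝒰 , Systematic.hasDimension core-form.systematic) ,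
    λ (H , H⊆𝒰 , H-dim) → ℓ-maximal H H⊆𝒰 H-dim

  -- x ↦ xG is an isomorphism onto `C`, so it carries a basis of `X` to one of the intersection. `X`
  -- is tied to `V` only by two implications, so that it can be the preimage of `V` by definition or
  -- the annihilator of `core`, which is that preimage only up to a proof.
  codeword-dimension : ∀ {X : Pred (Vector Carrier k) 0ℓ} (V : Subspace (K^ n)) →
    (∀ {x} → x ∈ X → codeword x ∈ Subspace.Member V) → (∀ {x} → codeword x ∈ Subspace.Member V → x ∈ X) →
    ∀ {e} → K^.HasDimension k X e → K^.HasDimension n (Subspace.Member V ∩ C.Member) e
  codeword-dimension V X⇒V V⇒X {e} (b , b-basis) = codeword ∘ b , record
    { inside      = λ i → X⇒V (B.inside i) , codeword-∈ (b i)
    ; independent = Combinations.injective⇒independent (K^ n) λ {a} {a′} eq →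
        Combinations.independent⇒injective (K^ k) B.independent (codeword-injective λ j →
          trans (sym (combination-codeword a j)) (trans (eq j) (combination-codeword a′ j)))
    ; spanning    = λ (v∈V , v∈C) → spanning v∈V (codeword-surjective v∈C)
    }
    where
    module B = LinearAlgebra.IsBasis b-basis

    combination-codeword : ∀ a → K^.combination n a (codeword ∘ b) ≋ codeword (K^.combination k a b)
    combination-codeword a j = begin
      K^.combination n a (codeword ∘ b) j   ≡⟨ combination-pointwise a (codeword ∘ b) j ⟩
      a · (λ i → b i · (λ l → G l j))       ≈⟨ ·-assoc a b (λ l → G l j) ⟨
      (λ l → a · (λ i → b i l)) · (λ l → G l j)
        ≈⟨ ·-congʳ (λ l → G l j) (λ l → reflexive (≡.sym (combination-pointwise a b l))) ⟩
      codeword (K^.combination k a b) j     ∎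

    spanning : ∀ {v} → v ∈ Subspace.Member V → ∃[ x ] v ≋ codeword x → v ∈ K^.Span n (codeword ∘ b)
    spanning v∈V (x , v≋xG) with a , x≋ ← B.spanning (V⇒X (Subspace.≈-closed V v≋xG v∈V)) =
      a , λ j → trans (v≋xG j) (trans (codeword-cong x≋ j) (sym (combination-codeword a j)))

  codewordsIn : Subspace (K^ n) → Subspace (K^ k)
  codewordsIn V = record
    { Member    = λ x → codeword x ∈ V.Member
    ; ≈-closed  = λ x≋y → V.≈-closed (codeword-cong x≋y)
    ; 0-closed  = V.≈-closed (λ j → sym (trans (sum-cong-≋ (λ i → zeroˡ (G i j))) (sum-replicate-zero k))) V.0-closed
    ; +-closed  = λ {x} {y} x∈ y∈ → V.≈-closed (λ j → sym (·-distribʳ (λ i → G i j) x y)) (V.+-closed x∈ y∈)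
    ; *ₗ-closed = λ a {x} x∈ → V.≈-closed (λ j → sym (·-scaleˡ a x (λ i → G i j))) (V.*ₗ-closed a x∈)
    }
    where module V = Subspace V

  -- Membership in Λ_q(n,m) forces the entries of the graph form into F, because θ maps V to
  -- itself and fixes the pivot coordinates (0 or 1) of the basis vectors.
  module Descent (V : Subspace (K^ n)) (V-invariant : θ-Invariant V) (V-form : GraphForm V) where
    open GraphForm V-form

    A-fixed : ∀ i j → frob (A i j) ≈ A i j
    A-fixed i j = trans (frob-cong (sym (entry i))) (trans (θb≋b i (frees σ j)) (entry i))
      where
      b : Fin d → Vector Carrier n
      b i = graphPoint (δ i)

      entry : ∀ i → b i (frees σ j) ≈ A i j
      entry i = trans (reflexive (merge-frees σ (δ i) _ j)) (δ-· i (λ i → A i j))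

      frob-δ : ∀ {t} (i l : Fin t) → frob (δ i l) ≈ δ i l
      frob-δ zero    zero    = trans (frob-cong (sym ι.1#-homo)) (trans (frob-ι F.1#) ι.1#-homo)
      frob-δ zero    (suc l) = frob-0
      frob-δ (suc i) zero    = frob-0
      frob-δ (suc i) (suc l) = frob-δ i l

      θb≋b : ∀ i → θ (b i) ≋ b i
      θb≋b i = graph-determined
        (proj₁ equals (proj₁ V-invariant (b i , proj₂ equals (graphPoint-∈ (δ i)) , λ _ → refl)))
        (graphPoint-∈ (δ i))
        (λ l → trans (frob-cong (graphPoint-pivots (δ i) l))
                     (trans (frob-δ i l) (sym (graphPoint-pivots (δ i) l))))

    a : Fin d → Fin c → F.Carrier
    a i j = proj₁ (frob-fixed (A i j) (A-fixed i j))

    ιa≈A : ∀ i j → ι.⟦ a i j ⟧ ≈ A i j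
    ιa≈A i j = proj₂ (frob-fixed (A i j) (A-fixed i j))

    private module Fσ = F.Split-equations σ a

    ι-cograph : ∀ {u} → u ∈ Fσ.CoGraph → ι.⟦_⟧ ∘ u ∈ CoGraph
    ι-cograph {u} u∈ i = begin
      ι.⟦ u (pivots σ i) ⟧ + A i · (ι.⟦_⟧ ∘ u ∘ frees σ)
        ≈⟨ +-congˡ (·-congʳ (ι.⟦_⟧ ∘ u ∘ frees σ) (ιa≈A i)) ⟨
      ι.⟦ u (pivots σ i) ⟧ + (ι.⟦_⟧ ∘ a i) · (ι.⟦_⟧ ∘ u ∘ frees σ)
        ≈⟨ +-congˡ (ι-· (a i) (u ∘ frees σ)) ⟨
      ι.⟦ u (pivots σ i) ⟧ + ι.⟦ a i F.· (u ∘ frees σ) ⟧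
        ≈⟨ ι.+-homo _ _ ⟨
      ι.⟦ Fσ.residue u i ⟧
        ≈⟨ trans (ι.⟦⟧-cong (u∈ i)) ι.0#-homo ⟩
      0# ∎

    module X⊥ (X-form : GraphForm (codewordsIn V)) where
      private
        module X = GraphForm X-form

      u : Vector F.Carrier c → Vector F.Carrier n
      u = Fσ.cographPoint

      point-u-∈ : ∀ y → point (u y) ∈ X.CoGraph
      point-u-∈ y = X.⊥graph⇒cograph λ i → trans (sym (codeword·ι (X.graphPoint (δ i)) (u y)))
        (graph⊥cograph (proj₁ equals (proj₂ X.equals (X.graphPoint-∈ (δ i)))) (ι-cograph {u y} (Fσ.cographPoint-∈ y)))

      -- Restricting Gu to the free coordinates of X^⊥ loses nothing, because they determine its
      -- members. So `Ψ` embeds the rational dual of `V` into a coordinate space over K, and the two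
      -- sizes can be compared.
      Ψ : Vector F.Carrier c → Vector Carrier X.c
      Ψ y = point (u y) ∘ frees X.σ

      Ψ-injective : ∀ {y y′} → Ψ y ≋ Ψ y′ → y F.≋ y′
      Ψ-injective {y} {y′} eq j = F.trans (F.sym (Fσ.cographPoint-frees y j)) (F.trans
        (point-injective (X.cograph-determined (point-u-∈ y) (point-u-∈ y′) eq) (frees σ j))
        (Fσ.cographPoint-frees y′ j))

      c≤ : c ≤ m ℕ.* X.c
      c≤ = ^-cancelʳ-≤ F.1<s (≡.subst (q ^ c ≤_) (ℕ.^-*-assoc q m X.c)
        (injective⇒≤ (vectorCounted F.counting c) (vectorCounted counting X.c) Ψ Ψ-injective))

      Ψ-surjective : c ≡ m ℕ.* X.c → ∀ z → ∃[ y ] Ψ y ≋ z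
      Ψ-surjective c≡ = injective⇒surjective (vectorCounted F.counting c) (vectorCounted counting X.c) Ψ Ψ-injective
        (≡.trans (cong (q ^_) c≡) (≡.sym (ℕ.^-*-assoc q m X.c)))

      -- With equal sizes `Ψ` is onto, so each member of X^⊥ shares its free coordinates with some
      -- Gu and therefore equals it.
      full : c ≡ m ℕ.* X.c → X.CoGraph ⊆ 𝒰.Member
      full c≡ {z} z∈ = let y , eq = Ψ-surjective c≡ (z ∘ frees X.σ) in
        𝒰.≈-closed (X.cograph-determined (point-u-∈ y) z∈ eq) (point-∈ (u y))

  -- Lower bound on the dimension of a candidate subspace

  WeightCandidate : ℕ → Pred ℕ _
  WeightCandidate r d = ∃ λ (V : Subspace (K^ n)) →
    θ-Invariant V
    × (∃[ e ] (K^.HasDimension n (Subspace.Member V ∩ C.Member) e × r ≤ e))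
    × K^.HasDimension n (Subspace.Member V) d

  -- The inequality makes `w` the least candidate at `ρ`; the equality case prevents any `r` below
  -- `ρ` from reaching the bound. Both are read off the same echelon forms of `V` and of its
  -- preimage X in K^k.
  candidate-bound : ∀ {r d} → d ∈ WeightCandidate r →
                    n ≤ d ℕ.+ m ℕ.* (k ∸ r) × (n ≡ d ℕ.+ m ℕ.* (k ∸ r) → k ∸ r ≤ ℓ)
  candidate-bound {r} {d} (V , V-invariant , (e , V∩C-dim , r≤e) , V-dim@(b , b-basis)) = bound , tight
    where
    module V = Subspace V
    module B = LinearAlgebra.IsBasis b-basis

    -- `V` comes as a bare predicate; its finite basis reduces membership to a search over
    -- coefficient vectors.
    V? : Decidable V.Member
    V? v = map′ (λ (a , v≋) → V.≈-closed (λ i → sym (v≋ i)) (Combinations.combination-∈ (K^ n) V a B.inside))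
                B.spanning (Dimension.Span? K (K^ n) ≋? b v)

    V-form = graphForm V V?
    X-form = graphForm (codewordsIn V) (V? ∘ codeword)
    module V-form = GraphForm V-form
    module X-form = GraphForm X-form
    open Descent V V-invariant V-form using (module X⊥)
    open X⊥ X-form

    d≡ : d ≡ V-form.d
    d≡ = ℕ.≤-antisym (Dimension.dimension-mono K (K^ n) V (λ v∈ → v∈) V-dim V-dim′)
                     (Dimension.dimension-mono K (K^ n) V (λ v∈ → v∈) V-dim′ V-dim)
      where V-dim′ = Systematic.hasDimension V-form.systematic

    V∩C : Subspace (K^ n)
    V∩C = record
      { Member    = V.Member ∩ C.Member
      ; ≈-closed  = λ v≋w (v∈V , v∈C) → V.≈-closed v≋w v∈V , C.≈-closed v≋w v∈C
      ; 0-closed  = V.0-closed , C.0-closed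
      ; +-closed  = λ (v∈V , v∈C) (w∈V , w∈C) → V.+-closed v∈V w∈V , C.+-closed v∈C w∈C
      ; *ₗ-closed = λ a (v∈V , v∈C) → V.*ₗ-closed a v∈V , C.*ₗ-closed a v∈C
      }

    r≤X : r ≤ X-form.d
    r≤X = ℕ.≤-trans r≤e (Dimension.dimension-mono K (K^ n) V∩C (λ v∈ → v∈) V∩C-dim
      (codeword-dimension V (λ x∈ → x∈) (λ x∈ → x∈) (Systematic.hasDimension X-form.systematic)))

    Xc≤ : X-form.c ≤ k ∸ r
    Xc≤ = ≡.subst (_≤ k ∸ r) (≡.trans (cong (_∸ X-form.d) (≡.sym (Split-+ X-form.σ))) (ℕ.m+n∸m≡n X-form.d X-form.c))
      (ℕ.∸-monoʳ-≤ k r≤X)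

    n≡ : n ≡ d ℕ.+ V-form.c
    n≡ = ≡.trans (≡.sym (Split-+ V-form.σ)) (cong (ℕ._+ V-form.c) (≡.sym d≡))

    bound : n ≤ d ℕ.+ m ℕ.* (k ∸ r)
    bound = ≡.subst (_≤ _) (≡.sym n≡) (ℕ.+-monoʳ-≤ d (ℕ.≤-trans c≤ (ℕ.*-monoʳ-≤ m Xc≤)))

    tight : n ≡ d ℕ.+ m ℕ.* (k ∸ r) → k ∸ r ≤ ℓ
    tight eq = ≡.subst (_≤ ℓ) Xc≡ (ℓ-maximal X-form.cograph (full (≡.trans c≡ (cong (m ℕ.*_) (≡.sym Xc≡))))
      (Systematic.hasDimension X-form.cograph-systematic))
      where
      c≡ : V-form.c ≡ m ℕ.* (k ∸ r)
      c≡ = ℕ.+-cancelˡ-≡ d _ _ (≡.trans (≡.sym n≡) eq)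
      Xc≡ : X-form.c ≡ k ∸ r
      -- The missing inequality comes from m (k - r) = c ≤ m · X.c, where m is nonzero and cancels.
      Xc≡ = ℕ.≤-antisym Xc≤ (ℕ.*-cancelˡ-≤ m (≡.subst (_≤ m ℕ.* X-form.c) c≡ c≤))

  -- The subspace that attains the bound

  point⁻¹core : Subspace (F^ n)
  point⁻¹core = record
    { Member    = λ u → point u ∈ core.Member
    ; ≈-closed  = λ u≋v → core.≈-closed (point-cong u≋v)
    ; 0-closed  = core.≈-closed (λ i → sym (trans (·-congˡ (G i) (λ _ → ι.0#-homo)) (·-zeroʳ (G i)))) core.0-closed
    ; +-closed  = λ {u} {v} u∈ v∈ → core.≈-closed
        (λ i → sym (trans (·-congˡ (G i) (λ j → ι.+-homo (u j) (v j))) (·-distribˡ (G i) (ι.⟦_⟧ ∘ u) (ι.⟦_⟧ ∘ v))))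
        (core.+-closed u∈ v∈)
    ; *ₗ-closed = λ a {u} u∈ → core.≈-closed
        (λ i → sym (trans (·-congˡ (G i) (λ j → ι.*-homo a (u j))) (·-scaleʳ ι.⟦ a ⟧ (G i) (ι.⟦_⟧ ∘ u))))
        (core.*ₗ-closed ι.⟦ a ⟧ u∈)
    }

  private
    module W = F.GraphForm (F.graphForm point⁻¹core (core? ∘ point))
    module Kσ = Split-equations W.σ (λ i j → ι.⟦ W.A i j ⟧)

  -- Free coordinates count the codimension: `ρ` is k - ℓ, and `w` is n minus the F-dimension of the
  -- space of all u with Gu in `core`, that is, the dimension of its dual over K.
  ρ w : ℕ
  ρ = core-form.c
  w = W.c

  ℓ+ρ≡k : ℓ ℕ.+ ρ ≡ k
  ℓ+ρ≡k = Split-+ core-form.σ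

  ι-graph : ∀ {u} → u ∈ W.Graph → ι.⟦_⟧ ∘ u ∈ Kσ.Graph
  ι-graph {u} u∈ j = trans (ι.⟦⟧-cong (u∈ j)) (ι-· (u ∘ pivots W.σ) (λ i → W.A i j))

  -- Each of the q^(mℓ) points of `core` lies in 𝒰 and so is Gu for some u in `point⁻¹core`, a space
  -- of F-dimension n - w. The opposite inequality is `candidate-bound` applied to `w-candidate`,
  -- and together they give equality.
  w+mℓ≤n : w ℕ.+ m ℕ.* ℓ ≤ n
  w+mℓ≤n = ≡.subst (w ℕ.+ m ℕ.* ℓ ≤_) (≡.trans (ℕ.+-comm w W.d) (Split-+ W.σ))
    (ℕ.+-monoʳ-≤ w (^-cancelʳ-≤ F.1<s (≡.subst (_≤ q ^ W.d) (ℕ.^-*-assoc q m ℓ)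
      (injective⇒≤ (vectorCounted counting ℓ) (vectorCounted F.counting W.d) (λ x → u x ∘ pivots W.σ) injective))))
    where
    preimage : ∀ x → ∃[ u ] core-form.graphPoint x ≋ point u
    preimage x = point-surjective (core⊆𝒰 (proj₂ core-form.equals (core-form.graphPoint-∈ x)))
    u : Vector Carrier ℓ → Vector F.Carrier n
    u x = proj₁ (preimage x)
    u-∈ : ∀ x → u x ∈ W.Graph
    u-∈ x = proj₁ W.equals (core.≈-closed (proj₂ (preimage x)) (proj₂ core-form.equals (core-form.graphPoint-∈ x)))
    injective : ∀ {x y} → u x ∘ pivots W.σ F.≋ u y ∘ pivots W.σ → x ≋ y
    injective {x} {y} eq i = begin
      x i                                          ≈⟨ core-form.graphPoint-pivots x i ⟨
      core-form.graphPoint x (pivots core-form.σ i)  ≈⟨ proj₂ (preimage x) _ ⟩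
      point (u x) (pivots core-form.σ i)           ≈⟨ point-cong (W.graph-determined (u-∈ x) (u-∈ y) eq) _ ⟩
      point (u y) (pivots core-form.σ i)           ≈⟨ proj₂ (preimage y) _ ⟨
      core-form.graphPoint y (pivots core-form.σ i)  ≈⟨ core-form.graphPoint-pivots y i ⟩
      y i                                          ∎

  θ-surjective : ∀ {t} (y : Vector Carrier t) → ∃[ x ] θ x ≋ y
  θ-surjective y = (λ i → proj₁ (frob-surjective (y i))) , λ i → proj₂ (frob-surjective (y i))

  θ-residue : ∀ x i → frob (Kσ.residue x i) ≈ Kσ.residue (θ x) i
  θ-residue x i = trans (frob-+ _ _) (+-congˡ (trans (frob-· (λ j → ι.⟦ W.A i j ⟧) (x ∘ frees W.σ))
    (·-congʳ (θ x ∘ frees W.σ) (λ j → frob-ι (W.A i j)))))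

  -- The defining equations have coefficients in F, so θ commutes with `residue`. Equality, rather
  -- than mere inclusion, of the image rests on the Frobenius map being a bijection of K.
  V-invariant : θ-Invariant Kσ.cograph
  V-invariant =
      (λ (x , x∈ , θx≋y) → Subspace.≈-closed Kσ.cograph θx≋y λ i →
        trans (sym (θ-residue x i)) (trans (frob-cong (x∈ i)) frob-0))
    , (λ {y} y∈ → let x , θx≋y = θ-surjective y in
        x , (λ i → frob-injective (trans (θ-residue x i)
              (trans (Subspace.≈-closed Kσ.cograph (λ j → sym (θx≋y j)) y∈ i) (sym frob-0)))) , θx≋y)

  -- The equations of V are rational vectors u with Gu in `core`, and xG · u = x · Gu. The converse
  -- `V⇒core⊥` uses that, `core` lying inside 𝒰, every member of it has the form Gu.
  core⊥⇒V : ∀ {x} → x ∈ core-form.CoGraph → codeword x ∈ Kσ.CoGraph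
  core⊥⇒V {x} x∈ = Kσ.⊥graph⇒cograph λ i → begin
    Kσ.graphPoint (δ i) · codeword x
      -- The i-th row over K is the image under ι of the i-th row over F: both lie in the graph and
      -- agree at the pivots.
      ≈⟨ ·-congʳ (codeword x) (Kσ.graph-determined
           (ι-graph {W.graphPoint (F.δ i)} (W.graphPoint-∈ (F.δ i))) (Kσ.graphPoint-∈ (δ i)) (ιδ i)) ⟨
    (ι.⟦_⟧ ∘ W.graphPoint (F.δ i)) · codeword x   ≈⟨ ·-comm (ι.⟦_⟧ ∘ W.graphPoint (F.δ i)) (codeword x) ⟩
    codeword x · (ι.⟦_⟧ ∘ W.graphPoint (F.δ i))   ≈⟨ codeword·ι x (W.graphPoint (F.δ i)) ⟩
    x · point (W.graphPoint (F.δ i))              ≈⟨ ·-comm x (point (W.graphPoint (F.δ i))) ⟩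
    point (W.graphPoint (F.δ i)) · x
      ≈⟨ core-form.graph⊥cograph (proj₁ core-form.equals (proj₂ W.equals (W.graphPoint-∈ (F.δ i)))) x∈ ⟩
    0# ∎
    where
    ι-δ : ∀ {t} (i j : Fin t) → ι.⟦ F.δ i j ⟧ ≈ δ i j
    ι-δ zero    zero    = ι.1#-homo
    ι-δ zero    (suc j) = ι.0#-homo
    ι-δ (suc i) zero    = ι.0#-homo
    ι-δ (suc i) (suc j) = ι-δ i j
    ιδ : ∀ i → ι.⟦_⟧ ∘ W.graphPoint (F.δ i) ∘ pivots W.σ ≋ Kσ.graphPoint (δ i) ∘ pivots W.σ
    ιδ i j = trans (ι.⟦⟧-cong (W.graphPoint-pivots (F.δ i) j)) (trans (ι-δ i j) (sym (Kσ.graphPoint-pivots (δ i) j)))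

  V⇒core⊥ : ∀ {x} → codeword x ∈ Kσ.CoGraph → x ∈ core-form.CoGraph
  V⇒core⊥ {x} xG∈ = core-form.⊥graph⇒cograph λ i →
    let h = core-form.graphPoint (δ i)
        h∈ = proj₂ core-form.equals (core-form.graphPoint-∈ (δ i))
        u , h≋ = point-surjective (core⊆𝒰 h∈) in begin
    h · x                        ≈⟨ ·-congʳ x h≋ ⟩
    point u · x                  ≈⟨ ·-comm (point u) x ⟩
    x · point u                  ≈⟨ codeword·ι x u ⟨
    codeword x · (ι.⟦_⟧ ∘ u)     ≈⟨ ·-comm (codeword x) (ι.⟦_⟧ ∘ u) ⟩
    (ι.⟦_⟧ ∘ u) · codeword x     ≈⟨ Kσ.graph⊥cograph (ι-graph {u} (proj₁ W.equals (core.≈-closed h≋ h∈))) xG∈ ⟩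
    0#                           ∎

  w-candidate : w ∈ WeightCandidate ρ
  w-candidate = Kσ.cograph , V-invariant ,
    (ρ , codeword-dimension Kσ.cograph core⊥⇒V V⇒core⊥ (Systematic.hasDimension core-form.cograph-systematic) , ℕ.≤-refl) ,
    Systematic.hasDimension Kσ.cograph-systematic

  0-candidate : 0 ∈ WeightCandidate 0
  0-candidate = zeroSubspace , zero-invariant , (0 , trivial proj₁ , z≤n) , trivial (λ v∈ → v∈)
    where
    zeroSubspace : Subspace (K^ n)
    zeroSubspace = record
      { Member    = λ v → v ≋ (λ _ → 0#)
      ; ≈-closed  = λ v≋w v≋0 i → trans (sym (v≋w i)) (v≋0 i)
      ; 0-closed  = λ _ → refl
      ; +-closed  = λ v≋0 w≋0 i → trans (+-cong (v≋0 i) (w≋0 i)) (+-identityˡ 0#)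
      ; *ₗ-closed = λ a v≋0 i → trans (*-congˡ (v≋0 i)) (zeroʳ a)
      }
    zero-invariant : θ-Invariant zeroSubspace
    zero-invariant = (λ (x , x≋0 , θx≋y) i → trans (sym (θx≋y i)) (trans (frob-cong (x≋0 i)) frob-0))
                   , (λ y≋0 → (λ _ → 0#) , (λ _ → refl) , λ i → trans frob-0 (sym (y≋0 i)))
    trivial : ∀ {S : Pred (Vector Carrier n) 0ℓ} → (∀ {v} → v ∈ S → v ≋ (λ _ → 0#)) → K^.HasDimension n S 0
    trivial S⊆0 = (λ ()) , record { inside = λ () ; independent = λ _ _ () ; spanning = λ v∈ → (λ ()) , S⊆0 v∈ }

  -- The zero subspace is a candidate for r = 0, so the convention for the zeroth weight agrees with
  -- the minimum and the case r = 0, which is attained when ℓ = k, follows the general argument.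
  weight⇒minimum : ∀ r {d} → IsGeneralizedRankWeight C r d → IsMinimum (WeightCandidate r) d
  weight⇒minimum zero    (lift ≡.refl) = 0-candidate , λ _ → z≤n
  weight⇒minimum (suc r) min           = min

  minimum⇒weight : ∀ r {d} → IsMinimum (WeightCandidate r) d → IsGeneralizedRankWeight C r d
  minimum⇒weight zero    (_ , minimal) = lift (ℕ.n≤0⇒n≡0 (minimal 0-candidate))
  minimum⇒weight (suc r) min           = min

  k∸ρ≡ℓ : k ∸ ρ ≡ ℓ
  k∸ρ≡ℓ = ≡.trans (cong (_∸ ρ) (≡.sym ℓ+ρ≡k)) (ℕ.m+n∸n≡m ℓ ρ)

  n≡w+m[k∸ρ] : n ≡ w ℕ.+ m ℕ.* (k ∸ ρ)
  n≡w+m[k∸ρ] = ℕ.≤-antisym (proj₁ (candidate-bound w-candidate))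
    (≡.subst (λ l → w ℕ.+ m ℕ.* l ≤ n) (≡.sym k∸ρ≡ℓ) w+mℓ≤n)

  w-weight : IsGeneralizedRankWeight C ρ w
  w-weight = minimum⇒weight ρ (w-candidate , λ {d} d∈ →
    ℕ.+-cancelʳ-≤ (m ℕ.* (k ∸ ρ)) w d (≡.subst (_≤ d ℕ.+ m ℕ.* (k ∸ ρ)) n≡w+m[k∸ρ] (proj₁ (candidate-bound d∈))))

  -- The equality case gives k ∸ r ≤ ℓ, hence ℓ + ρ = k ≤ ℓ + r.
  ρ-minimal : ∀ {r d} → IsGeneralizedRankWeight C r d → n ≡ d ℕ.+ m ℕ.* (k ∸ r) → ρ ≤ r
  ρ-minimal {r} d-weight eq = ℕ.+-cancelˡ-≤ ℓ ρ r (≡.subst (_≤ ℓ ℕ.+ r) (≡.sym ℓ+ρ≡k)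
    (ℕ.≤-trans (ℕ.m≤n+m∸n k r) (≡.subst (r ℕ.+ (k ∸ r) ≤_) (ℕ.+-comm r ℓ)
      (ℕ.+-monoʳ-≤ r (proj₂ (candidate-bound (proj₁ (weight⇒minimum r d-weight))) eq)))))

-- The weight equation over the integers

open import Data.Integer.Base as ℤ using (+_; _-_; _*_)
open import Algebra.Properties.AbelianGroup ℤ.+-0-abelianGroup using (//-rightDividesˡ; x≈z//y)

+[k∸r] : ∀ {k r} → r ≤ k → + (k ∸ r) ≡ + k - + r
+[k∸r] {k} {r} r≤k = ≡.sym (≡.trans (ℤ.m-n≡m⊖n k r) (ℤ.⊖-≥ r≤k))

module _ {n m k r w : ℕ} (r≤k : r ≤ k) where
  private
    defect : + (m ℕ.* (k ∸ r)) ≡ (+ k - + r) * + m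
    defect = ≡.trans (cong +_ (ℕ.*-comm m (k ∸ r)))
      (≡.trans (ℤ.pos-* (k ∸ r) m) (cong (_* + m) (+[k∸r] r≤k)))

  -- n - (k - r) m may be negative, so the theorem compares integers; moving the subtracted term
  -- across gives an equation of natural numbers, and r ≤ k makes truncated subtraction faithful.
  defect⇒+ : + w ≡ + n - (+ k - + r) * + m → n ≡ w ℕ.+ m ℕ.* (k ∸ r)
  defect⇒+ eq = ℤ.+-injective (≡.trans (≡.sym (//-rightDividesˡ D (+ n)))
    (≡.cong₂ ℤ._+_ (≡.sym eq) (≡.sym defect)))
    where D = (+ k - + r) * + m

  +⇒defect : n ≡ w ℕ.+ m ℕ.* (k ∸ r) → + w ≡ + n - (+ k - + r) * + m
  +⇒defect eq = x≈z//y (+ w) ((+ k - + r) * + m) (+ n)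
    (≡.trans (cong (ℤ._+_ (+ w)) (≡.sym defect)) (cong +_ (≡.sym eq)))

lemma6p13 : ∀ {q n m k : ℕ} .{{_ : NonZero n}} .{{_ : NonZero m}} .{{_ : NonZero k}} →
    IsPrimePower q →
    (F : FiniteField q) (K : FiniteField (q ^ m))
    (ι : RingHomomorphism (FiniteField.rawRing F) (FiniteField.rawRing K)) →
    let open RankMetric {q} {m} F K ι in
    (Γ : OrderedBasis) (C : Code n k) → Nondegenerate Γ C →
    (𝒰 : System n k) → 𝒰 CorrespondsTo C →
    ∃[ l ] ∃[ ρ ]
    (IsLinearityIndex 𝒰 l
    × IsMinimum
    (λ r → r ≤ k
    × ∃[ w ] (IsGeneralizedRankWeight C r w
    × + w ≡ + n - (+ k - + r) * + m))
    ρ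
    × + l ≡ + k - + ρ)
lemma6p13 {n = n} q-primePower F K ι _ C _ 𝒰 (G , G-generates , 𝒰≐columns) =
  ℓ , ρ , ℓ-isLinearityIndex ,
  ((ρ≤k , w , w-weight , +⇒defect {n} ρ≤k n≡w+m[k∸ρ]) ,
   λ (r≤k , _ , d-weight , eq) → ρ-minimal d-weight (defect⇒+ {n} r≤k eq)) ,
  ≡.trans (cong +_ (≡.sym k∸ρ≡ℓ)) (+[k∸r] ρ≤k)
  where
  open Correspondence q-primePower F K ι C 𝒰 G G-generates 𝒰≐columns
  ρ≤k = ≡.subst (ρ ≤_) ℓ+ρ≡k (ℕ.m≤n+m ρ ℓ)
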